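{- Let $R$ be any one of the following four subsets of $\{0,1,2,3\}^2$: (A33) $\{(0,2),(1,0),(1,1),(1,2),(2,2),(3,0),(3,1),(3,2)\}$; (A34) $\{(0,1),(0,2),(0,3),(1,1),(2,1),(2,2),(2,3),(3,1)\}$; (A35) $\{(0,1),(0,3),(1,1),(1,3),(2,0),(2,1),(2,2),(2,3)\}$; (A36) $\{(1,0),(1,1),(1,2),(1,3),(2,0),(2,2),(3,0),(3,2)\}$. Let $q_1=(123,R)$, $q_2=(321,R)$. Then $q_1$ and $q_2$ are jointly equidistributed. Moreover, letting $T_{n,k,\ell}$ be the number of $\pi\in S_n$ with exactly $k$ occurrences of $q_1$ and exactly $\ell$ occurrences of $q_2$ (with $T_{n,k,\ell}=0$ whenever $k<0$ or $\ell<0$), for $n\ge 4$ \[ T_{n,k,\ell}=(n-2)T_{n-1,k,\ell}+T_{n-1,k-1,\ell}+T_{n-1,k,\ell-1}+T_{n-2,k,\ell}-T_{n-2,k-1,\ell-1}, \] with initial conditions $T_{2,0,0}=2$, $T_{3,0,0}=4$, $T_{3,1,0}=T_{3,0,1}=1$, and $T_{n,k,\ell}=0$ for $k,\ell\ge n-1$. Equivalently, with $T_n(x,y)=\sum_{k=0}^{n-2}\sum_{\ell=0}^{n-2}T_{n,k,\ell}x^ky^\ell$, \[ T_n(x,y)=(n+x+y-2)T_{n-1}(x,y)+(1-xy)T_{n-2}(x,y),\qquad n\ge 4, \] with $T_2(x,y)=2$ and $T_3(x,y)=x+y+4$.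
   Context: $S_n$ is the set of permutations of $\{1,\dots,n\}$. A mesh pattern of length $k$ is a pair $(\tau,R)$ with $\tau\in S_k$ and $R\subseteq\{0,\dots,k\}^2$; the element $(a,b)\in R$ is the "shaded box" whose corners are $(a,b),(a,b+1),(a+1,b+1),(a+1,b)$ in the plot of $\tau$ (first coordinate = position, second = value). An occurrence of $(\tau,R)$ in $\pi=\pi_1\cdots\pi_n\in S_n$ is a tuple of indices $i_1<\dots<i_k$ such that $\pi_{i_1}\cdots\pi_{i_k}$ is order-isomorphic to $\tau$ and, setting $i_0=0$, $i_{k+1}=n+1$, letting $v_1<\dots<v_k$ be the values $\pi_{i_1},\dots,\pi_{i_k}$ in increasing order and $v_0=0$, $v_{k+1}=n+1$, for every $(a,b)\in R$ there is no index $m$ with $i_a<m<i_{a+1}$ and $v_b<\pi_m<v_{b+1}$. The number of occurrences is the number of such index tuples. Two mesh patterns $q_1,q_2$ are jointly equidistributed if for all $n\ge 1$ and all integers $k,\ell\ge 0$, the number of $\pi\in S_n$ with exactly $k$ occurrences of $q_1$ and exactly $\ell$ occurrences of $q_2$ equals the number with exactly $\ell$ occurrences of $q_1$ and exactly $k$ occurrences of $q_2$. -}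

module Defs where

open import Data.Nat using (ℕ; zero; suc; _∸_; _<ᵇ_; _≡ᵇ_; _≤ᵇ_)
open import Data.Bool using (Bool; true; false; _∧_; not; _xor_; if_then_else_)
open import Data.List using (List; []; _∷_; [_]; _++_; map; concatMap; filterᵇ; length; upTo)
open import Data.Product using (_×_; _,_)
open import Data.Integer using (ℤ; +_; -[1+_])

all : {A : Set} → (A → Bool) → List A → Bool
all p []       = true
all p (x ∷ xs) = p x ∧ all p xs

at : List ℕ → ℕ → ℕ
at []       _       = 0
at (x ∷ xs) zero    = x
at (x ∷ xs) (suc i) = at xs i

oneTo : ℕ → List ℕ
oneTo n = map suc (upTo n)

words : ℕ → ℕ → List (List ℕ)
words n zero    = [ [] ]
words n (suc m) = concatMap (λ w → map (λ x → x ∷ w) (oneTo n)) (words n m)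

count : ℕ → List ℕ → ℕ
count v []       = 0
count v (x ∷ xs) = if v ≡ᵇ x then suc (count v xs) else count v xs

-- a word of length n over {1..n} is a permutation iff every value occurs exactly once
isPerm : ℕ → List ℕ → Bool
isPerm n w = all (λ v → count v w ≡ᵇ 1) (oneTo n)

S : ℕ → List (List ℕ)
S n = filterᵇ (λ w → isPerm n w) (words n n)

insert : ℕ → List ℕ → List ℕ
insert x []       = [ x ]
insert x (y ∷ ys) = if x ≤ᵇ y then x ∷ y ∷ ys else y ∷ insert x ys

sort : List ℕ → List ℕ
sort []       = []
sort (x ∷ xs) = insert x (sort xs)

strictInc : List ℕ → Bool
strictInc []           = true
strictInc (x ∷ [])     = true
strictInc (x ∷ y ∷ ys) = (x <ᵇ y) ∧ strictInc (y ∷ ys)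

_⇔ᵇ_ : Bool → Bool → Bool
a ⇔ᵇ b = not (a xor b)

-- A mesh pattern (τ , R): τ a permutation of length k in one-line notation,
-- R a list of shaded boxes (a , b) ∈ {0..k}².
record MeshPattern : Set where
  constructor mesh
  field
    τ : List ℕ
    R : List (ℕ × ℕ)
open MeshPattern public

-- Is the index tuple ι = (i₁,…,i_k) (1-based positions) an occurrence of p in π?
isOcc : MeshPattern → List ℕ → List ℕ → Bool
isOcc p π ι =
  strictInc ι ∧ (orderIso ∧ shadingOK)
  where
    n = length π
    k = length (τ p)
    val : ℕ → ℕ
    val i = at π (i ∸ 1)
    orderIso : Bool
    orderIso = all (λ a → all (λ b →
                 (at (τ p) a <ᵇ at (τ p) b) ⇔ᵇ (val (at ι a) <ᵇ val (at ι b)))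
                 (upTo k)) (upTo k)
    P : List ℕ
    P = 0 ∷ ι ++ [ suc n ]
    V : List ℕ
    V = 0 ∷ sort (map val ι) ++ [ suc n ]
    boxOK : ℕ × ℕ → Bool
    boxOK (a , b) = all (λ m → not ((at P a <ᵇ m) ∧ (m <ᵇ at P (suc a))
                                   ∧ (at V b <ᵇ val m) ∧ (val m <ᵇ at V (suc b))))
                        (oneTo n)
    shadingOK : Bool
    shadingOK = all boxOK (R p)

occ : MeshPattern → List ℕ → ℕ
occ p π = length (filterᵇ (λ ι → isOcc p π ι) (words (length π) (length (τ p))))

R-A33 R-A34 R-A35 R-A36 : List (ℕ × ℕ)
R-A33 = (0 , 2) ∷ (1 , 0) ∷ (1 , 1) ∷ (1 , 2) ∷ (2 , 2) ∷ (3 , 0) ∷ (3 , 1) ∷ (3 , 2) ∷ []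
R-A34 = (0 , 1) ∷ (0 , 2) ∷ (0 , 3) ∷ (1 , 1) ∷ (2 , 1) ∷ (2 , 2) ∷ (2 , 3) ∷ (3 , 1) ∷ []
R-A35 = (0 , 1) ∷ (0 , 3) ∷ (1 , 1) ∷ (1 , 3) ∷ (2 , 0) ∷ (2 , 1) ∷ (2 , 2) ∷ (2 , 3) ∷ []
R-A36 = (1 , 0) ∷ (1 , 1) ∷ (1 , 2) ∷ (1 , 3) ∷ (2 , 0) ∷ (2 , 2) ∷ (3 , 0) ∷ (3 , 2) ∷ []

q₁ q₂ : List (ℕ × ℕ) → MeshPattern
q₁ R = mesh (1 ∷ 2 ∷ 3 ∷ []) R
q₂ R = mesh (3 ∷ 2 ∷ 1 ∷ []) R

jointCount : MeshPattern → MeshPattern → ℕ → ℕ → ℕ → ℕ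
jointCount a b n k ℓ =
  length (filterᵇ (λ π → (occ a π ≡ᵇ k) ∧ (occ b π ≡ᵇ ℓ)) (S n))

JointlyEquidistributed : MeshPattern → MeshPattern → Set
JointlyEquidistributed a b =
  ∀ (n k ℓ : ℕ) → 1 Data.Nat.≤ n → jointCount a b n k ℓ ≡ jointCount a b n ℓ k
  where open import Relation.Binary.PropositionalEquality using (_≡_)

T : List (ℕ × ℕ) → ℕ → ℕ → ℕ → ℕ
T R = jointCount (q₁ R) (q₂ R)

Tℤ : List (ℕ × ℕ) → ℕ → ℤ → ℤ → ℤ
Tℤ R n (+ k)    (+ ℓ)    = + T R n k ℓ
Tℤ R n (+ k)    -[1+ _ ] = + 0
Tℤ R n -[1+ _ ] _        = + 0

{-# OPTIONS --safe #-}
module Submission where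

-- The four shadings form one orbit under inversion and reverse-complement, which preserve 123 and
-- 321, so it is enough to treat (A36).  There no box of column 0 is shaded, so prepending a value p
-- to a permutation u of 1,…,n (raising the values ≥ p) keeps all occurrences.  Let f be the first
-- value of u.  An occurrence using the new first entry is forced to be p, f and one value further
-- on; it exists for q₁ iff p = 1 and f ≠ n, and for q₂ iff p = f + 1 and f ≠ 1.  Let T, F, L be the
-- generating functions over all u, over those with f = n and over those with f = 1, where x marks q₁
-- and y marks q₂, and T′, F′, L′ the same for n + 1.  Then T′ = (n-1+x+y) T + (1-x) F + (1-y) L,
-- F′ = T + (y-1) F and L′ = x T + (1-x) F for n ≥ 2;
-- since (1-x) F′ + (1-y) L′ = (1-xy) T, the recurrence follows; it is symmetric in x and y.

open import Defs
open import Data.Nat using (ℕ; _≤_; _∸_)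
open import Data.Integer using (ℤ; +_; _+_; _-_; _*_)
open import Data.Product using (_×_)
open import Data.Sum using (_⊎_)
open import Relation.Binary.PropositionalEquality using (_≡_)

open import Data.Bool using (Bool; true; false; _∧_; not; if_then_else_) renaming (T to True)
open import Data.Bool.Properties using (T-∧; T-≡; T?)
open import Data.Integer using (-[1+_]; 0ℤ; 1ℤ)
import Data.Integer.Properties as ℤ
open import Data.Integer.Tactic.RingSolver using (solve-∀)
open import Data.List using (List; []; _∷_; [_]; _++_; map; reverse; concatMap; cartesianProductWith; filterᵇ; length; upTo; applyUpTo)
open import Data.List.Membership.Propositional using (_∈_; _∉_)
open import Data.List.Membership.Propositional.Properties using (∈-filter⁺; ∈-filter⁻; ∈-map⁺; ∈-map⁻; ∈-++⁺ˡ; ∈-++⁺ʳ; ∈-++⁻; ∈-∃++; ∈-upTo⁺; ∈-upTo⁻; ∈-cartesianProductWith⁺; ∈-cartesianProductWith⁻)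
open import Data.List.Membership.Propositional.Properties.WithK using (unique∧set⇒bag)
open import Data.List.Properties using (length-++; length-map; length-upTo; length-applyUpTo; map-∘; map-id-local; map-injective; ∷-injective)
open import Data.List.Relation.Binary.BagAndSetEquality using (∼bag⇒↭)
open import Data.List.Relation.Binary.Permutation.Propositional as ↭ using (_↭_)
open import Data.List.Relation.Unary.All as All using (All; []; _∷_)
import Data.List.Relation.Unary.All.Properties as All
open import Data.List.Relation.Unary.AllPairs using ([]; _∷_)
open import Data.List.Relation.Unary.Any using (here; there)
open import Data.List.Relation.Unary.Unique.Propositional using (Unique)
import Data.List.Relation.Unary.Unique.Propositional.Properties as Unique
import Data.Nat as ℕ
open import Data.Nat using (zero; suc; pred; z≤n; s≤s; s≤s⁻¹; _<_; _<ᵇ_; _≤ᵇ_; _≡ᵇ_; _≟_; _≤?_)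
open import Data.Nat.Properties hiding (_≟_; _≤?_)
import Data.Product.Properties as Product
open import Data.List.Membership.DecPropositional (Product.≡-dec _≟_ _≟_) using (_∈?_)
open import Data.Product using (_,_; proj₁; proj₂; ∃; ∃-syntax; swap)
open import Data.Sum using (inj₁; inj₂)
open import Data.Unit using (tt)
open import Function using (_∘_; id; mk⇔; Equivalence)
open import Relation.Binary.Definitions using (tri<; tri≈; tri>)
open import Relation.Binary.PropositionalEquality hiding ([_])
open import Relation.Nullary using (¬_; Dec; yes; no; contradiction; from-yes; _×-dec_; ¬?)

-- No symmetry of the square that exchanges 123 and 321 preserves one of the four shadings, so the
-- equidistribution is not visible in the plot; it is read off the recurrence and the cases n = 1,
-- 2, 3. An occurrence through the first entry is forced because column 1 is shaded completely, row
-- 0 in columns 1 to 3 and row 2 in columns 1 to 3. The resulting triple makes every shaded box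
-- degenerate, so its emptiness costs nothing. The exceptions f = n and f = 1 are the cases in which
-- the remaining value does not exist: f + 2 would exceed n + 1, or 1 would have to be smaller than
-- f = 1. They are the reason why T alone gives no first-order recurrence and F and L must be
-- carried along. The equation for F′ needs n ≥ 2 because for n = 1 the two exceptions coincide;
-- this is why the recurrence starts at n = 4. Generating functions are handled through their
-- coefficients, with integer indices, so that multiplication by x or y is a shift of an index.

private variable
  A B C : Set

-- Boolean reflection and counting by bijections

infix 4 _∈[1…_]

_∈[1…_] : ℕ → ℕ → Set
i ∈[1… n ] = 1 ≤ i × i ≤ n

∈-oneTo⁺ : ∀ {n i} → i ∈[1… n ] → i ∈ oneTo n
∈-oneTo⁺ {i = suc i} (_ , i<n) = ∈-map⁺ suc (∈-upTo⁺ i<n)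

∈-oneTo⁻ : ∀ {n i} → i ∈ oneTo n → i ∈[1… n ]
∈-oneTo⁻ i∈ with _ , j∈ , refl ← ∈-map⁻ suc i∈ = s≤s z≤n , ∈-upTo⁻ j∈

oneTo-unique : ∀ n → Unique (oneTo n)
oneTo-unique n = Unique.map⁺ suc-injective (Unique.upTo⁺ n)

T-∧⁻ : ∀ {x y} → True (x ∧ y) → True x × True y
T-∧⁻ = Equivalence.to T-∧

T-∧⁺ : ∀ {x y} → True x → True y → True (x ∧ y)
T-∧⁺ tx ty = Equivalence.from T-∧ (tx , ty)

all⁺ : ∀ {p : A → Bool} xs → (∀ {x} → x ∈ xs → True (p x)) → True (all p xs)
all⁺ []       h = _
all⁺ (x ∷ xs) h = T-∧⁺ (h (here refl)) (all⁺ xs (h ∘ there))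

all⁻ : ∀ {p : A → Bool} {xs} → True (all p xs) → ∀ {x} → x ∈ xs → True (p x)
all⁻ h (here refl) = proj₁ (T-∧⁻ h)
all⁻ h (there x∈)  = all⁻ (proj₂ (T-∧⁻ h)) x∈

≡ᵇ-true : ∀ {m n} → m ≡ n → (m ≡ᵇ n) ≡ true
≡ᵇ-true {m} {n} eq = Equivalence.to T-≡ (≡⇒≡ᵇ m n eq)

≡ᵇ-false : ∀ {m n} → m ≢ n → (m ≡ᵇ n) ≡ false
≡ᵇ-false {m} {n} m≢n with m ≡ᵇ n in eq
... | false = refl
... | true  = contradiction (≡ᵇ⇒≡ m n (Equivalence.from T-≡ eq)) m≢n

-- Induction on `xs`: the image of the head is deleted from `ys`, and by injectivity the images of
-- the tail survive the deletion.
injection-length : ∀ (f : A → B) {xs ys} → Unique xs →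
                   (∀ {x} → x ∈ xs → f x ∈ ys) →
                   (∀ {x y} → x ∈ xs → y ∈ xs → f x ≡ f y → x ≡ y) →
                   length xs ≤ length ys
injection-length f {[]}     _         _   _   = z≤n
injection-length f {x ∷ xs} (x∉ ∷ xs!) f∈ inj with ∈-∃++ (f∈ (here refl))
... | as , bs , refl = begin
  suc (length xs)                ≤⟨ s≤s (injection-length f xs! f∈′ (λ y∈ z∈ → inj (there y∈) (there z∈))) ⟩
  suc (length (as ++ bs))        ≡⟨ cong suc (length-++ as) ⟩
  suc (length as ℕ.+ length bs)    ≡⟨ +-suc (length as) (length bs) ⟨
  length as ℕ.+ suc (length bs)    ≡⟨ length-++ as ⟨
  length (as ++ f x ∷ bs)        ∎
  where
  open ≤-Reasoning
  f∈′ : ∀ {y} → y ∈ xs → f y ∈ as ++ bs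
  f∈′ {y} y∈ with ∈-++⁻ as (f∈ (there y∈))
  ... | inj₁ ∈as         = ∈-++⁺ˡ ∈as
  ... | inj₂ (there ∈bs) = ∈-++⁺ʳ as ∈bs
  ... | inj₂ (here eq)   = contradiction (inj (here refl) (there y∈) (sym eq)) (All.lookup x∉ y∈)

-- The maps have to be mutually inverse on the members of the lists only: inversion and
-- reverse-complement of words undo themselves on permutations, not on arbitrary words.
bijection-length : ∀ (f : A → B) (g : B → A) {xs ys} → Unique xs → Unique ys →
                   (∀ {x} → x ∈ xs → f x ∈ ys × g (f x) ≡ x) →
                   (∀ {y} → y ∈ ys → g y ∈ xs × f (g y) ≡ y) →
                   length xs ≡ length ys
bijection-length f g xs! ys! fok gok = ≤-antisym
  (injection-length f xs! (proj₁ ∘ fok) (injective f g fok))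
  (injection-length g ys! (proj₁ ∘ gok) (injective g f gok))
  where
  injective : ∀ {A B : Set} (f : A → B) (g : B → A) {xs ys} → (∀ {x} → x ∈ xs → f x ∈ ys × g (f x) ≡ x) →
              ∀ {x y} → x ∈ xs → y ∈ xs → f x ≡ f y → x ≡ y
  injective f g ok x∈ y∈ eq =
    trans (sym (proj₂ (ok x∈))) (trans (cong g eq) (proj₂ (ok y∈)))

∈-filterᵇ⁺ : ∀ {p : A → Bool} {x xs} → x ∈ xs → True (p x) → x ∈ filterᵇ p xs
∈-filterᵇ⁺ {p = p} = ∈-filter⁺ (T? ∘ p)

∈-filterᵇ⁻ : ∀ {p : A → Bool} {x xs} → x ∈ filterᵇ p xs → x ∈ xs × True (p x)
∈-filterᵇ⁻ {p = p} = ∈-filter⁻ (T? ∘ p)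

filterᵇ-unique : ∀ (p : A → Bool) {xs} → Unique xs → Unique (filterᵇ p xs)
filterᵇ-unique p = Unique.filter⁺ (T? ∘ p)

concatMap-map : ∀ (f : A → B → C) xs ys →
                concatMap (λ x → map (f x) ys) xs ≡ cartesianProductWith f xs ys
concatMap-map f []       ys = refl
concatMap-map f (x ∷ xs) ys = cong (map (f x) ys ++_) (concatMap-map f xs ys)

-- Words and permutations

-- Despite the name, `x` goes in front; the arguments come in the order in which `words` runs
-- through them.
snoc : List ℕ → ℕ → List ℕ
snoc w x = x ∷ w

words-suc : ∀ n m → words n (suc m) ≡ cartesianProductWith snoc (words n m) (oneTo n)
words-suc n m = concatMap-map snoc (words n m) (oneTo n)

words-unique : ∀ n m → Unique (words n m)
words-unique n zero    = [] ∷ []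
words-unique n (suc m) = subst Unique (sym (words-suc n m))
  (Unique.cartesianProductWith⁺ snoc (λ eq → let x≡ , w≡ = ∷-injective eq in w≡ , x≡)
    (words-unique n m) (oneTo-unique n))

∈-words⁺ : ∀ {n} w → All (_∈[1… n ]) w → w ∈ words n (length w)
∈-words⁺ []            []         = here refl
∈-words⁺ {n} (x ∷ w) (px ∷ pw) = subst (_ ∈_) (sym (words-suc n (length w)))
  (∈-cartesianProductWith⁺ snoc (∈-words⁺ w pw) (∈-oneTo⁺ px))

∈-words⁻ : ∀ {n} m {w} → w ∈ words n m → length w ≡ m × All (_∈[1… n ]) w
∈-words⁻ zero (here refl) = refl , []
∈-words⁻ {n} (suc m) w∈
  with u , x , u∈ , x∈ , refl ← ∈-cartesianProductWith⁻ snoc (words n m) (oneTo n) (subst (_ ∈_) (words-suc n m) w∈)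
  = let len , rng = ∈-words⁻ m u∈ in cong suc len , ∈-oneTo⁻ x∈ ∷ rng

count-here : ∀ v {x} w → v ≡ x → count v (x ∷ w) ≡ suc (count v w)
count-here v w eq rewrite ≡ᵇ-true eq = refl

count-there : ∀ v {x} w → v ≢ x → count v (x ∷ w) ≡ count v w
count-there v w neq rewrite ≡ᵇ-false neq = refl

count≡0⇒∉ : ∀ v w → count v w ≡ 0 → v ∉ w
count≡0⇒∉ v (x ∷ w) eq (here v≡x) = contradiction (trans (sym (count-here v w v≡x)) eq) λ ()
count≡0⇒∉ v (x ∷ w) eq (there v∈) with v ≟ x
... | yes v≡x = contradiction (trans (sym (count-here v w v≡x)) eq) λ ()
... | no  v≢x = count≡0⇒∉ v w (trans (sym (count-there v w v≢x)) eq) v∈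

∉⇒count≡0 : ∀ v w → v ∉ w → count v w ≡ 0
∉⇒count≡0 v []      v∉ = refl
∉⇒count≡0 v (x ∷ w) v∉ =
  trans (count-there v w (v∉ ∘ here)) (∉⇒count≡0 v w (v∉ ∘ there))

count≡1⇒∈ : ∀ v w → count v w ≡ 1 → v ∈ w
count≡1⇒∈ v (x ∷ w) eq with v ≟ x
... | yes v≡x = here v≡x
... | no  v≢x = there (count≡1⇒∈ v w (trans (sym (count-there v w v≢x)) eq))

count-map : ∀ (f : ℕ → ℕ) → (∀ {x y} → f x ≡ f y → x ≡ y) →
            ∀ v w → count (f v) (map f w) ≡ count v w
count-map f inj v []      = refl
count-map f inj v (x ∷ w) with v ≟ x
... | yes refl = trans (count-here (f v) (map f w) refl)
                   (trans (cong suc (count-map f inj v w)) (sym (count-here v w refl)))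
... | no  v≢x  = trans (count-there (f v) (map f w) (v≢x ∘ inj))
                   (trans (count-map f inj v w) (sym (count-there v w v≢x)))

record IsPermutation (n : ℕ) (w : List ℕ) : Set where
  constructor isPermutation
  field
    length≡ : length w ≡ n
    range   : All (_∈[1… n ]) w
    once    : ∀ {v} → v ∈[1… n ] → count v w ≡ 1
open IsPermutation

∈-S⁺ : ∀ {n w} → IsPermutation n w → w ∈ S n
∈-S⁺ {n} {w} (isPermutation len rng one) = ∈-filterᵇ⁺
  (subst (λ m → w ∈ words n m) len (∈-words⁺ w rng))
  (all⁺ (oneTo n) (λ v∈ → ≡⇒≡ᵇ _ 1 (one (∈-oneTo⁻ v∈))))

∈-S⁻ : ∀ {n w} → w ∈ S n → IsPermutation n w
∈-S⁻ {n} {w} w∈ with w∈words , perm ← ∈-filterᵇ⁻ {xs = words n n} w∈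
                  | len , rng ← ∈-words⁻ n (proj₁ (∈-filterᵇ⁻ {p = isPerm n} {xs = words n n} w∈))
  = isPermutation len rng (λ v∈ → ≡ᵇ⇒≡ _ 1 (all⁻ perm (∈-oneTo⁺ v∈)))

S-unique : ∀ n → Unique (S n)
S-unique n = filterᵇ-unique (isPerm n) (words-unique n n)

-- Permutations as mutually inverse functions

val : List ℕ → ℕ → ℕ
val w i = at w (i ∸ 1)

-- junk value: one more than the length if v does not occur
pos : List ℕ → ℕ → ℕ
pos []      v = 1
pos (x ∷ w) v = if v ≡ᵇ x then 1 else suc (pos w v)

-- Everything is required on 1,...,n only, since `val` and `pos` take junk values elsewhere.
-- Carrying both functions makes inversion an exchange of two arguments.
record Inverses (n : ℕ) (π σ : ℕ → ℕ) : Set where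
  field
    π-range : ∀ {i} → i ∈[1… n ] → π i ∈[1… n ]
    σ-range : ∀ {v} → v ∈[1… n ] → σ v ∈[1… n ]
    π∘σ     : ∀ {v} → v ∈[1… n ] → π (σ v) ≡ v
    σ∘π     : ∀ {i} → i ∈[1… n ] → σ (π i) ≡ i
open Inverses

flip-Inverses : ∀ {n π σ} → Inverses n π σ → Inverses n σ π
flip-Inverses I = record
  { π-range = σ-range I ; σ-range = π-range I ; π∘σ = σ∘π I ; σ∘π = π∘σ I }

at-∈ : ∀ w {i} → i < length w → at w i ∈ w
at-∈ (x ∷ w) {zero}  _         = here refl
at-∈ (x ∷ w) {suc i} (s≤s i<) = there (at-∈ w i<)

∈-pos : ∀ {v} w → v ∈ w → pos w v ∈[1… length w ] × val w (pos w v) ≡ v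
∈-pos {v} (x ∷ w) v∈ with v ≟ x
... | yes v≡x rewrite ≡ᵇ-true v≡x = (s≤s z≤n , s≤s z≤n) , sym v≡x
... | no  v≢x rewrite ≡ᵇ-false v≢x with v∈
...   | here v≡x = contradiction v≡x v≢x
...   | there v∈w with pos w v | ∈-pos w v∈w
...     | suc p | (_ , p≤) , eq = (s≤s z≤n , s≤s p≤) , eq

-- `pos` stops at the first place where `v` stands; multiplicity one excludes any earlier place than
-- `i`.
pos-at : ∀ {v} w → count v w ≡ 1 → ∀ {i} → i < length w → at w i ≡ v → pos w v ≡ suc i
pos-at {v} (x ∷ w) one {i} i< eq with v ≟ x
pos-at {v} (x ∷ w) one {zero}  _  eq | yes v≡x rewrite ≡ᵇ-true v≡x = refl
pos-at {v} (x ∷ w) one {suc i} (s≤s i<) eq | yes v≡x =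
  contradiction (subst (_∈ w) eq (at-∈ w i<))
    (count≡0⇒∉ v w (suc-injective (trans (sym (count-here v w v≡x)) one)))
pos-at {v} (x ∷ w) one {zero}  _  eq | no v≢x = contradiction (sym eq) v≢x
pos-at {v} (x ∷ w) one {suc i} (s≤s i<) eq | no v≢x =
  trans (cong (if_then 1 else suc (pos w v)) (≡ᵇ-false v≢x))
    (cong suc (pos-at w (trans (sym (count-there v w v≢x)) one) i< eq))

permutation⇒Inverses : ∀ {n w} → IsPermutation n w → Inverses n (val w) (pos w)
permutation⇒Inverses {n} {w} (isPermutation refl rng one) = record
  { π-range = π-rng
  ; σ-range = λ v∈ → proj₁ (∈-pos w (count≡1⇒∈ _ w (one v∈)))
  ; π∘σ     = λ v∈ → proj₂ (∈-pos w (count≡1⇒∈ _ w (one v∈)))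
  ; σ∘π     = λ { {suc i} (1≤ , i<) → pos-at w (one (π-rng (1≤ , i<))) i< refl }
  }
  where
  π-rng : ∀ {i} → i ∈[1… length w ] → val w i ∈[1… length w ]
  π-rng {suc i} (_ , i<) = All.lookup rng (at-∈ w i<)

word : ℕ → (ℕ → ℕ) → List ℕ
word n π = applyUpTo (π ∘ suc) n

at-applyUpTo : ∀ (f : ℕ → ℕ) {n i} → i < n → at (applyUpTo f n) i ≡ f i
at-applyUpTo f {suc n} {zero}  _        = refl
at-applyUpTo f {suc n} {suc i} (s≤s i<) = at-applyUpTo (f ∘ suc) i<

val-word : ∀ {n} π {i} → i ∈[1… n ] → val (word n π) i ≡ π i
val-word π {suc i} (_ , i<) = at-applyUpTo (π ∘ suc) i<

applyUpTo-at : ∀ w → applyUpTo (at w) (length w) ≡ w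
applyUpTo-at []      = refl
applyUpTo-at (x ∷ w) = cong (x ∷_) (applyUpTo-at w)

applyUpTo-cong : ∀ {f g : ℕ → ℕ} n → (∀ {i} → i < n → f i ≡ g i) → applyUpTo f n ≡ applyUpTo g n
applyUpTo-cong zero    h = refl
applyUpTo-cong (suc n) h = cong₂ _∷_ (h (s≤s z≤n)) (applyUpTo-cong n (h ∘ s≤s))

word-ext : ∀ {n π w} → length w ≡ n → (∀ {i} → i ∈[1… n ] → π i ≡ val w i) → word n π ≡ w
word-ext {n} {π} {w} refl h = trans (applyUpTo-cong n (λ i< → h (s≤s z≤n , i<))) (applyUpTo-at w)

∈-applyUpTo : ∀ {P : ℕ → Set} (f : ℕ → ℕ) n → (∀ {i} → i < n → P (f i)) → All P (applyUpTo f n)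
∈-applyUpTo f zero    h = []
∈-applyUpTo f (suc n) h = h (s≤s z≤n) ∷ ∈-applyUpTo (f ∘ suc) n (h ∘ s≤s)

∈⇒at : ∀ {v} w → v ∈ w → ∃ λ i → i < length w × at w i ≡ v
∈⇒at (x ∷ w) (here refl) = 0 , s≤s z≤n , refl
∈⇒at (x ∷ w) (there v∈)  = let i , i< , eq = ∈⇒at w v∈ in suc i , s≤s i< , eq

count-at : ∀ {v} w i → i < length w → at w i ≡ v →
           (∀ {j} → j < length w → at w j ≡ v → j ≡ i) → count v w ≡ 1
count-at {v} (x ∷ w) zero _ x≡v uniq = trans (count-here v w (sym x≡v)) (cong suc (∉⇒count≡0 v w v∉))
  where
  v∉ : v ∉ w
  v∉ v∈ with j , j< , eq ← ∈⇒at w v∈ with () ← uniq {suc j} (s≤s j<) eq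
count-at {v} (x ∷ w) (suc i) (s≤s i<) eq uniq = trans (count-there v w v≢x)
  (count-at w i i< eq (λ j< eq′ → suc-injective (uniq (s≤s j<) eq′)))
  where
  v≢x : v ≢ x
  v≢x v≡x with () ← uniq {zero} (s≤s z≤n) (sym v≡x)

-- The value `v` stands at place `σ v` because `π` undoes `σ`, and nowhere else because `σ` undoes
-- `π`.
word-permutation : ∀ {n π σ} → Inverses n π σ → IsPermutation n (word n π)
word-permutation {n} {π} {σ} I = isPermutation len rng one
  where
  len : length (word n π) ≡ n
  len = length-applyUpTo (π ∘ suc) n
  rng : All (_∈[1… n ]) (word n π)
  rng = ∈-applyUpTo (π ∘ suc) n (λ i< → π-range I (s≤s z≤n , i<))
  one : ∀ {v} → v ∈[1… n ] → count v (word n π) ≡ 1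
  one {v} v∈ with σ v in σv≡ | σ-range I v∈
  ... | suc i | σv∈ = count-at (word n π) i (subst (i <_) (sym len) (proj₂ σv∈))
        (trans (val-word π σv∈) (trans (cong π (sym σv≡)) (π∘σ I v∈)))
        (λ {j} j< eq → let j∈ = s≤s z≤n , subst (suc j ≤_) len j< in
          suc-injective (trans (sym (σ∘π I j∈))
            (trans (cong σ (trans (sym (val-word π j∈)) eq)) σv≡)))

-- Occurrences as propositions

data Direction : Set where
  inc dec : Direction

q : Direction → List (ℕ × ℕ) → MeshPattern
q inc = q₁
q dec = q₂

Chain : ℕ → ℕ → ℕ → ℕ → Set
Chain n i j k = 1 ≤ i × i < j × j < k × k ≤ n

-- Positions i < j < k and values a < b < c are both listed in increasing order, in either direction,
-- so that inversion simply exchanges the two triples.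
Match : Direction → (ℕ → ℕ) → (i j k a b c : ℕ) → Set
Match inc π i j k a b c = π i ≡ a × π j ≡ b × π k ≡ c
Match dec π i j k a b c = π i ≡ c × π j ≡ b × π k ≡ a

-- The grid lines of the plot in one coordinate, borders 0 and `suc n` included; the same function
-- serves positions and values.
cut : ℕ → List ℕ → ℕ → ℕ
cut n x a = at (0 ∷ x ++ [ suc n ]) a

Between : ℕ → List ℕ → ℕ → ℕ → Set
Between n x a m = cut n x a < m × m < cut n x (suc a)

InBox : ℕ → (x y : List ℕ) → ℕ × ℕ → (m v : ℕ) → Set
InBox n x y (a , b) m v =
  cut n x a < m × m < cut n x (suc a) × cut n y b < v × v < cut n y (suc b)

Empty : List (ℕ × ℕ) → ℕ → (ℕ → ℕ) → (x y : List ℕ) → Set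
Empty R n π x y = ∀ {box} → box ∈ R → ∀ {m} → m ∈[1… n ] → ¬ InBox n x y box m (π m)

-- The values are supplied already in increasing order, which removes `sort` from all later
-- arguments.
data IsOccurrence (d : Direction) (R : List (ℕ × ℕ)) (n : ℕ) (π : ℕ → ℕ) : List ℕ → Set where
  occurrence : ∀ {i j k a b c} → Chain n i j k → Chain n a b c → Match d π i j k a b c →
               Empty R n π (i ∷ j ∷ k ∷ []) (a ∷ b ∷ c ∷ []) →
               IsOccurrence d R n π (i ∷ j ∷ k ∷ [])

-- The Boolean occurrence test against the proposition

T-not-not⁻ : ∀ {x} → True (not (not x)) → True x
T-not-not⁻ {true} _ = tt

T-not⁻ : ∀ {x} → True (not x) → ¬ True x
T-not⁻ {false} _ ()

T-not⁺ : ∀ {x} → ¬ True x → True (not x)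
T-not⁺ {true}  ¬x = contradiction tt ¬x
T-not⁺ {false} _  = tt

<ᵇ-true : ∀ {m n} → m < n → (m <ᵇ n) ≡ true
<ᵇ-true = Equivalence.to T-≡ ∘ <⇒<ᵇ

<ᵇ-false : ∀ {m n} → n ≤ m → (m <ᵇ n) ≡ false
<ᵇ-false {m} {n} n≤m with m <ᵇ n in eq
... | false = refl
... | true  = contradiction (<ᵇ⇒< m n (Equivalence.from T-≡ eq)) (≤⇒≯ n≤m)

≤ᵇ-true : ∀ {m n} → m ≤ n → (m ≤ᵇ n) ≡ true
≤ᵇ-true = Equivalence.to T-≡ ∘ ≤⇒≤ᵇ

≤ᵇ-false : ∀ {m n} → n < m → (m ≤ᵇ n) ≡ false
≤ᵇ-false {m} {n} n<m with m ≤ᵇ n in eq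
... | false = refl
... | true  = contradiction (≤ᵇ⇒≤ m n (Equivalence.from T-≡ eq)) (<⇒≱ n<m)

sort-increasing : ∀ {a b c} → a < b → b < c → sort (a ∷ b ∷ c ∷ []) ≡ a ∷ b ∷ c ∷ []
sort-increasing a<b b<c rewrite ≤ᵇ-true (<⇒≤ b<c) | ≤ᵇ-true (<⇒≤ a<b) = refl

sort-decreasing : ∀ {a b c} → a < b → b < c → sort (c ∷ b ∷ a ∷ []) ≡ a ∷ b ∷ c ∷ []
sort-decreasing a<b b<c
  rewrite ≤ᵇ-false a<b | ≤ᵇ-false (<-trans a<b b<c) | ≤ᵇ-false b<c = refl

private
  clear : ℕ → (x y : List ℕ) → ℕ × ℕ → (m v : ℕ) → Bool
  clear n x y (a , b) m v =
    not ((cut n x a <ᵇ m) ∧ (m <ᵇ cut n x (suc a)) ∧ (cut n y b <ᵇ v) ∧ (v <ᵇ cut n y (suc b)))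

  clear⇒ : ∀ {n x y box m v} → True (clear n x y box m v) → ¬ InBox n x y box m v
  clear⇒ h (p< , m< , l< , v<) =
    T-not⁻ h (T-∧⁺ (<⇒<ᵇ p<) (T-∧⁺ (<⇒<ᵇ m<) (T-∧⁺ (<⇒<ᵇ l<) (<⇒<ᵇ v<))))

  clear⇐ : ∀ {n x y box m v} → ¬ InBox n x y box m v → True (clear n x y box m v)
  clear⇐ h = T-not⁺ λ t →
    let t₁ , t = T-∧⁻ t; t₂ , t = T-∧⁻ t; t₃ , t₄ = T-∧⁻ t
    in h (<ᵇ⇒< _ _ t₁ , <ᵇ⇒< _ _ t₂ , <ᵇ⇒< _ _ t₃ , <ᵇ⇒< _ _ t₄)

  one-line : Direction → List ℕ
  one-line inc = 1 ∷ 2 ∷ 3 ∷ []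
  one-line dec = 3 ∷ 2 ∷ 1 ∷ []

  agree : Direction → List ℕ → (x : List ℕ) → (a b : ℕ) → Bool
  agree d w x a b = (at (one-line d) a <ᵇ at (one-line d) b) ⇔ᵇ (val w (at x a) <ᵇ val w (at x b))

  isomorphic : Direction → List ℕ → (x : List ℕ) → Bool
  isomorphic d w x = all (λ a → all (agree d w x a) (upTo 3)) (upTo 3)

  unshaded : List (ℕ × ℕ) → List ℕ → (x y : List ℕ) → Bool
  unshaded R w x y = all (λ box → all (λ m → clear (length w) x y box m (val w m)) (oneTo (length w))) R

  isOcc-unfold : ∀ d R w i j k → let x = i ∷ j ∷ k ∷ [] in
    isOcc (q d R) w x ≡ strictInc x ∧ (isomorphic d w x ∧ unshaded R w x (sort (map (val w) x)))
  isOcc-unfold inc R w i j k = refl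
  isOcc-unfold dec R w i j k = refl

  isomorphic⇒agree : ∀ d w x → True (isomorphic d w x) → ∀ {a b} → a < 3 → b < 3 → True (agree d w x a b)
  isomorphic⇒agree d w x t {a} a< b< =
    all⁻ {p = agree d w x a} (all⁻ {p = λ a → all (agree d w x a) (upTo 3)} t (∈-upTo⁺ a<)) (∈-upTo⁺ b<)

  isomorphic-inc : ∀ w i j k → val w i < val w j → val w j < val w k →
                   True (isomorphic inc w (i ∷ j ∷ k ∷ []))
  isomorphic-inc w i j k a<b b<c
    rewrite <ᵇ-true a<b | <ᵇ-true b<c | <ᵇ-true (<-trans a<b b<c)
          | <ᵇ-false (<⇒≤ a<b) | <ᵇ-false (<⇒≤ b<c) | <ᵇ-false (<⇒≤ (<-trans a<b b<c))
          | <ᵇ-false (≤-refl {val w i}) | <ᵇ-false (≤-refl {val w j}) | <ᵇ-false (≤-refl {val w k}) = tt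

  isomorphic-dec : ∀ w i j k → val w k < val w j → val w j < val w i →
                   True (isomorphic dec w (i ∷ j ∷ k ∷ []))
  isomorphic-dec w i j k a<b b<c
    rewrite <ᵇ-true a<b | <ᵇ-true b<c | <ᵇ-true (<-trans a<b b<c)
          | <ᵇ-false (<⇒≤ a<b) | <ᵇ-false (<⇒≤ b<c) | <ᵇ-false (<⇒≤ (<-trans a<b b<c))
          | <ᵇ-false (≤-refl {val w i}) | <ᵇ-false (≤-refl {val w j}) | <ᵇ-false (≤-refl {val w k}) = tt

  isomorphic⇒ : ∀ d w i j k → True (isomorphic d w (i ∷ j ∷ k ∷ [])) →
    ∃ λ a → ∃ λ b → ∃ λ c → a < b × b < c × Match d (val w) i j k a b c
  isomorphic⇒ inc w i j k t = _ , _ , _ ,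
    -- Where the comparison of pattern entries is `true`, `⇔ᵇ` reduces to a double negation;
    -- comparing neighbours is enough to order the three values.
    <ᵇ⇒< (val w i) (val w j) (T-not-not⁻ (agree′ {0} {1} (s≤s z≤n) (s≤s (s≤s z≤n)))) ,
    <ᵇ⇒< (val w j) (val w k) (T-not-not⁻ (agree′ {1} {2} (s≤s (s≤s z≤n)) (s≤s (s≤s (s≤s z≤n))))) ,
    refl , refl , refl
    where agree′ = isomorphic⇒agree inc w (i ∷ j ∷ k ∷ []) t
  isomorphic⇒ dec w i j k t = _ , _ , _ ,
    <ᵇ⇒< (val w k) (val w j) (T-not-not⁻ (agree′ {2} {1} (s≤s (s≤s (s≤s z≤n))) (s≤s (s≤s z≤n)))) ,
    <ᵇ⇒< (val w j) (val w i) (T-not-not⁻ (agree′ {1} {0} (s≤s (s≤s z≤n)) (s≤s z≤n))) ,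
    refl , refl , refl
    where agree′ = isomorphic⇒agree dec w (i ∷ j ∷ k ∷ []) t

  isomorphic⇐ : ∀ d w {i j k a b c} → a < b → b < c → Match d (val w) i j k a b c →
                True (isomorphic d w (i ∷ j ∷ k ∷ []))
  isomorphic⇐ inc w {i} {j} {k} a<b b<c (refl , refl , refl) = isomorphic-inc w i j k a<b b<c
  isomorphic⇐ dec w {i} {j} {k} a<b b<c (refl , refl , refl) = isomorphic-dec w i j k a<b b<c

  sort-match : ∀ d {π i j k a b c} → a < b → b < c → Match d π i j k a b c →
               sort (map π (i ∷ j ∷ k ∷ [])) ≡ a ∷ b ∷ c ∷ []
  sort-match inc a<b b<c (refl , refl , refl) = sort-increasing a<b b<c
  sort-match dec a<b b<c (refl , refl , refl) = sort-decreasing a<b b<c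

  match-range : ∀ d {n π i j k a b c} → i ∈[1… n ] → k ∈[1… n ] →
                (∀ {m} → m ∈[1… n ] → π m ∈[1… n ]) →
                Match d π i j k a b c → 1 ≤ a × c ≤ n
  match-range inc i∈ k∈ rng (refl , _ , refl) = proj₁ (rng i∈) , proj₂ (rng k∈)
  match-range dec i∈ k∈ rng (refl , _ , refl) = proj₁ (rng k∈) , proj₂ (rng i∈)

isOcc⇒ : ∀ d {R n w i j k} → IsPermutation n w → i ∈[1… n ] → j ∈[1… n ] → k ∈[1… n ] →
         True (isOcc (q d R) w (i ∷ j ∷ k ∷ [])) →
         IsOccurrence d R n (val w) (i ∷ j ∷ k ∷ [])
isOcc⇒ d {R} {_} {w} {i} {j} {k} w∈@(isPermutation refl _ _) i∈ j∈ k∈ t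
  with tι , t ← T-∧⁻ {strictInc (i ∷ j ∷ k ∷ [])} (subst True (isOcc-unfold d R w i j k) t)
  with i<j , t′ ← T-∧⁻ {i <ᵇ j} tι
  with iso , free ← T-∧⁻ {isomorphic d w (i ∷ j ∷ k ∷ [])} t
  with a , b , c , a<b , b<c , match ← isomorphic⇒ d w i j k iso
  with 1≤a , c≤n ← match-range d i∈ k∈ (π-range (permutation⇒Inverses w∈)) match
  = occurrence (proj₁ i∈ , <ᵇ⇒< i j i<j , <ᵇ⇒< j k (proj₁ (T-∧⁻ t′)) , proj₂ k∈)
      (1≤a , a<b , b<c , c≤n) match
      λ {box} box∈ {m} m∈ → clear⇒ {n} {x} {a ∷ b ∷ c ∷ []} {box} {m}
        (all⁻ {p = λ m → clear n x (a ∷ b ∷ c ∷ []) box m (val w m)}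
          (all⁻ {p = λ box → all (λ m → clear n x (a ∷ b ∷ c ∷ []) box m (val w m)) (oneTo n)}
            (subst (True ∘ unshaded R w x) (sort-match d a<b b<c match) free) box∈)
          (∈-oneTo⁺ m∈))
  where
  n = length w
  x = i ∷ j ∷ k ∷ []

isOcc⇐ : ∀ d {R n w ι} → length w ≡ n → IsOccurrence d R n (val w) ι → True (isOcc (q d R) w ι)
isOcc⇐ d {R} {_} {w} refl (occurrence {i} {j} {k} {a} {b} {c} (_ , i<j , j<k , _) (_ , a<b , b<c , _) match empty) =
  subst True (sym (isOcc-unfold d R w i j k))
    (T-∧⁺ (T-∧⁺ (<⇒<ᵇ i<j) (T-∧⁺ (<⇒<ᵇ j<k) tt))
    (T-∧⁺ (isomorphic⇐ d w a<b b<c match)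
      (subst (True ∘ unshaded R w x) (sym (sort-match d a<b b<c match))
        (all⁺ R λ {box} box∈ → all⁺ (oneTo n) λ {m} m∈ →
          clear⇐ {n} {x} {a ∷ b ∷ c ∷ []} {box} {m} (empty box∈ (∈-oneTo⁻ m∈))))))
  where
  n = length w
  x = i ∷ j ∷ k ∷ []

-- Transport of occurrence counts and of joint counts

occurrences : Direction → List (ℕ × ℕ) → List ℕ → List (List ℕ)
occurrences d R w = filterᵇ (isOcc (q d R) w) (words (length w) 3)

occ-occurrences : ∀ d R w → occ (q d R) w ≡ length (occurrences d R w)
occ-occurrences inc R w = refl
occ-occurrences dec R w = refl

occurrences-unique : ∀ d R w → Unique (occurrences d R w)
occurrences-unique d R w = filterᵇ-unique (isOcc (q d R) w) (words-unique (length w) 3)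

∈-occurrences⁻ : ∀ d {R n w ι} → IsPermutation n w → ι ∈ occurrences d R w → IsOccurrence d R n (val w) ι
∈-occurrences⁻ d {R} {_} {w} w∈@(isPermutation refl _ _) ι∈
  with ι∈words , t ← ∈-filterᵇ⁻ {p = isOcc (q d R) w} {xs = words (length w) 3} ι∈
  with ∈-words⁻ {length w} 3 ι∈words
... | len , i∈ ∷ j∈ ∷ k∈ ∷ [] = isOcc⇒ d w∈ i∈ j∈ k∈ t

∈-occurrences⁺ : ∀ d {R n w ι} → IsPermutation n w → IsOccurrence d R n (val w) ι → ι ∈ occurrences d R w
∈-occurrences⁺ d {w = w} (isPermutation refl _ _) o@(occurrence (1≤i , i<j , j<k , k≤n) _ _ _) =
  ∈-filterᵇ⁺ (∈-words⁺ _ ((1≤i , ≤-trans (<⇒≤ i<j) (≤-trans (<⇒≤ j<k) k≤n))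
                        ∷ (≤-trans 1≤i (<⇒≤ i<j) , ≤-trans (<⇒≤ j<k) k≤n)
                        ∷ (≤-trans 1≤i (≤-trans (<⇒≤ i<j) (<⇒≤ j<k)) , k≤n) ∷ []))
             (isOcc⇐ d {w = w} refl o)

occ-bijection : ∀ d {R R′ n w w′} → IsPermutation n w → IsPermutation n w′ → (f g : List ℕ → List ℕ) →
  (∀ {ι} → IsOccurrence d R  n (val w)  ι → IsOccurrence d R′ n (val w′) (f ι) × g (f ι) ≡ ι) →
  (∀ {ι} → IsOccurrence d R′ n (val w′) ι → IsOccurrence d R  n (val w)  (g ι) × f (g ι) ≡ ι) →
  occ (q d R) w ≡ occ (q d R′) w′
occ-bijection d {R} {R′} {n} {w} {w′} w! w′! f g f-occ g-occ = begin
  occ (q d R) w                 ≡⟨ occ-occurrences d R w ⟩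
  length (occurrences d R w)    ≡⟨ bijection-length f g (occurrences-unique d R w) (occurrences-unique d R′ w′)
    (λ ι∈ → let o , eq = f-occ (∈-occurrences⁻ d w! ι∈) in ∈-occurrences⁺ d w′! o , eq)
    (λ ι∈ → let o , eq = g-occ (∈-occurrences⁻ d w′! ι∈) in ∈-occurrences⁺ d w! o , eq) ⟩
  length (occurrences d R′ w′)  ≡⟨ occ-occurrences d R′ w′ ⟨
  occ (q d R′) w′               ∎
  where open ≡-Reasoning

-- An involution serves as its own inverse in `bijection-length`, so it must carry the counts for
-- `R` to those for `R′` and also back. Both directions `d` are preserved by the same map, hence so
-- are the joint counts.
T-involution : ∀ {R R′} n (f : List ℕ → List ℕ) →
  (∀ {w} → IsPermutation n w → IsPermutation n (f w) × f (f w) ≡ w) →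
  (∀ d {w} → IsPermutation n w → occ (q d R) w ≡ occ (q d R′) (f w)) →
  (∀ d {w} → IsPermutation n w → occ (q d R′) w ≡ occ (q d R) (f w)) →
  ∀ k ℓ → T R n k ℓ ≡ T R′ n k ℓ
T-involution {R} {R′} n f f-perm f-occ f-occ′ k ℓ =
  bijection-length f f (filterᵇ-unique (P R) (S-unique n)) (filterᵇ-unique (P R′) (S-unique n))
    (into R R′ f-occ) (into R′ R f-occ′)
  where
  P : List (ℕ × ℕ) → List ℕ → Bool
  P R w = (occ (q₁ R) w ≡ᵇ k) ∧ (occ (q₂ R) w ≡ᵇ ℓ)
  into : ∀ R R′ → (∀ d {w} → IsPermutation n w → occ (q d R) w ≡ occ (q d R′) (f w)) → ∀ {w} →
    w ∈ filterᵇ (P R) (S n) → f w ∈ filterᵇ (P R′) (S n) × f (f w) ≡ w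
  into R R′ f-occ {w} w∈
    with w∈S , t ← ∈-filterᵇ⁻ {p = P R} {xs = S n} w∈
    with w! ← ∈-S⁻ {n} {w} w∈S
    with t₁ , t₂ ← T-∧⁻ t
    = ∈-filterᵇ⁺ {p = P R′} {xs = S n} (∈-S⁺ (proj₁ (f-perm w!)))
        (T-∧⁺ (≡⇒≡ᵇ _ k (trans (sym (f-occ inc w!)) (≡ᵇ⇒≡ (occ (q₁ R) w) k t₁)))
              (≡⇒≡ᵇ _ ℓ (trans (sym (f-occ dec w!)) (≡ᵇ⇒≡ (occ (q₂ R) w) ℓ t₂))))
    , proj₂ (f-perm w!)

-- Inversion

-- The values of an occurrence become the positions in the inverse, and these must increase: in a
-- descending occurrence the list is turned round.
image : Direction → (ℕ → ℕ) → List ℕ → List ℕ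
image inc π x = map π x
image dec π x = reverse (map π x)

-- Reflection in the diagonal exchanges the chain of positions with the chain of values and keeps
-- the direction, 123 and 321 being their own inverses. The point of `σ` above `m` is the reflection
-- of the point of `π` above `σ m`, so box (a , b) becomes (b , a).
occurrence-inverse : ∀ d {R R′ n π σ} → Inverses n π σ → (∀ {box} → box ∈ R′ → swap box ∈ R) →
  ∀ {ι} → IsOccurrence d R n π ι →
  IsOccurrence d R′ n σ (image d π ι) × image d σ (image d π ι) ≡ ι
occurrence-inverse d {R} {R′} {n} {π} {σ} I R′⊆
  (occurrence {i} {j} {k} {a} {b} {c} pos@(1≤i , i<j , j<k , k≤n) vals match empty) =
  invert d match
  where
  empty′ : Empty R′ n σ (a ∷ b ∷ c ∷ []) (i ∷ j ∷ k ∷ [])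
  empty′ {box} box∈ {m} m∈ (l₁ , u₁ , l₂ , u₂) = empty (R′⊆ box∈) (σ-range I m∈)
    (l₂ , u₂ , subst (_ <_) (sym (π∘σ I m∈)) l₁ , subst (_< _) (sym (π∘σ I m∈)) u₁)
  σπi : σ (π i) ≡ i
  σπi = σ∘π I (1≤i , ≤-trans (<⇒≤ i<j) (≤-trans (<⇒≤ j<k) k≤n))
  σπj : σ (π j) ≡ j
  σπj = σ∘π I (≤-trans 1≤i (<⇒≤ i<j) , ≤-trans (<⇒≤ j<k) k≤n)
  σπk : σ (π k) ≡ k
  σπk = σ∘π I (≤-trans 1≤i (≤-trans (<⇒≤ i<j) (<⇒≤ j<k)) , k≤n)
  invert : ∀ d → Match d π i j k a b c →
    IsOccurrence d R′ n σ (image d π (i ∷ j ∷ k ∷ []))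
    × image d σ (image d π (i ∷ j ∷ k ∷ [])) ≡ i ∷ j ∷ k ∷ []
  invert inc (refl , refl , refl) =
    occurrence vals pos (σπi , σπj , σπk) empty′ , cong₂ _∷_ σπi (cong₂ _∷_ σπj (cong₂ _∷_ σπk refl))
  invert dec (refl , refl , refl) =
    occurrence vals pos (σπk , σπj , σπi) empty′ , cong₂ _∷_ σπi (cong₂ _∷_ σπj (cong₂ _∷_ σπk refl))

occ-inverse : ∀ d {R R′ n w w′} → IsPermutation n w → IsPermutation n w′ → Inverses n (val w) (val w′) →
  (∀ {box} → box ∈ R′ → swap box ∈ R) → (∀ {box} → box ∈ R → swap box ∈ R′) →
  occ (q d R) w ≡ occ (q d R′) w′
occ-inverse d {w = w} {w′} w! w′! I R′⊆ R⊆ =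
  occ-bijection d w! w′! (image d (val w)) (image d (val w′))
    (occurrence-inverse d I R′⊆) (occurrence-inverse d (flip-Inverses I) R⊆)

inverse : ℕ → List ℕ → List ℕ
inverse n w = word n (pos w)

module _ {n : ℕ} {w : List ℕ} (w! : IsPermutation n w) where
  private
    I = permutation⇒Inverses w!

  inverse-permutation : IsPermutation n (inverse n w)
  inverse-permutation = word-permutation (flip-Inverses I)

  inverse-Inverses : Inverses n (val w) (val (inverse n w))
  inverse-Inverses = record
    { π-range = π-range I
    ; σ-range = λ v∈ → subst (_∈[1… n ]) (sym (val-word (pos w) v∈)) (σ-range I v∈)
    ; π∘σ     = λ v∈ → trans (cong (val w) (val-word (pos w) v∈)) (π∘σ I v∈)
    ; σ∘π     = λ i∈ → trans (val-word (pos w) (π-range I i∈)) (σ∘π I i∈) }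

inverse-involutive : ∀ {n w} → IsPermutation n w → inverse n (inverse n w) ≡ w
inverse-involutive {n} {w} w! = word-ext (length≡ w!) λ {i} i∈ → begin
  pos w′ i                ≡⟨ π∘σ I (σ-range I′ i∈) ⟨
  val w (val w′ (pos w′ i)) ≡⟨ cong (val w) (π∘σ I′ i∈) ⟩
  val w i                 ∎
  where
  open ≡-Reasoning
  w′ = inverse n w
  I  = inverse-Inverses w!
  I′ = permutation⇒Inverses (inverse-permutation w!)

T-inverse : ∀ {R R′} → (∀ {box} → box ∈ R′ → swap box ∈ R) → (∀ {box} → box ∈ R → swap box ∈ R′) →
            ∀ n k ℓ → T R n k ℓ ≡ T R′ n k ℓ
T-inverse R′⊆ R⊆ n = T-involution n (inverse n)
  (λ w! → inverse-permutation w! , inverse-involutive w!)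
  (λ d w! → occ-inverse d w! (inverse-permutation w!) (inverse-Inverses w!) R′⊆ R⊆)
  (λ d w! → occ-inverse d w! (inverse-permutation w!) (inverse-Inverses w!) R⊆ R′⊆)

-- Reverse-complement

rev : ℕ → ℕ → ℕ
rev n i = suc n ∸ i

rev-range : ∀ {n i} → i ∈[1… n ] → rev n i ∈[1… n ]
rev-range {n} {suc i} (_ , i<n) = m<n⇒0<n∸m i<n , m∸n≤m n i

rev-involutive : ∀ {n i} → i ≤ suc n → rev n (rev n i) ≡ i
rev-involutive = m∸[m∸n]≡n

rev-flipˡ : ∀ {n i k} → i ≤ suc n → i < rev n k → k < rev n i
rev-flipˡ {n} i≤ i< = ∸-cancelʳ-< {o = suc n} (subst (_< _) (sym (rev-involutive {n} i≤)) i<)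

rev-flipʳ : ∀ {n i k} → i ≤ suc n → rev n k < i → rev n i < k
rev-flipʳ {n} i≤ <i = ∸-cancelʳ-< {o = suc n} (subst (_ <_) (sym (rev-involutive {n} i≤)) <i)

rev-chain : ∀ {n i j k} → Chain n i j k → Chain n (rev n k) (rev n j) (rev n i)
rev-chain {n} {i} {j} {k} (1≤i , i<j , j<k , k≤n) =
  proj₁ (rev-range (≤-trans 1≤i (≤-trans (<⇒≤ i<j) (<⇒≤ j<k)) , k≤n)) ,
  ∸-monoʳ-< j<k k≤ , ∸-monoʳ-< i<j (≤-trans (<⇒≤ j<k) k≤) ,
  proj₂ (rev-range (1≤i , ≤-trans (<⇒≤ i<j) (≤-trans (<⇒≤ j<k) k≤n)))
  where
  k≤ = m≤n⇒m≤1+n k≤n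

opposite : ℕ × ℕ → ℕ × ℕ
opposite (a , b) = 3 ∸ a , 3 ∸ b

-- a ≤ 3 matters: cut returns the junk value 0 beyond index 4
rev-between : ∀ n i j k a {m} → a ≤ 3 → m ∈[1… n ] →
              Between n (rev n k ∷ rev n j ∷ rev n i ∷ []) a m →
              Between n (i ∷ j ∷ k ∷ []) (3 ∸ a) (rev n m)
rev-between n i j k 0 _ m∈@(_ , m≤n) (_ , u) =
  rev-flipˡ {n} {k = k} (m≤n⇒m≤1+n m≤n) u , s≤s (proj₂ (rev-range m∈))
rev-between n i j k 1 _ (_ , m≤n) (l , u) =
  rev-flipˡ {n} {k = j} (m≤n⇒m≤1+n m≤n) u , rev-flipʳ {n} {k = k} (m≤n⇒m≤1+n m≤n) l
rev-between n i j k 2 _ (_ , m≤n) (l , u) =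
  rev-flipˡ {n} {k = i} (m≤n⇒m≤1+n m≤n) u , rev-flipʳ {n} {k = j} (m≤n⇒m≤1+n m≤n) l
rev-between n i j k 3 _ m∈@(_ , m≤n) (l , u) =
  proj₁ (rev-range m∈) , rev-flipʳ {n} {k = i} (m≤n⇒m≤1+n m≤n) l
rev-between n i j k (suc (suc (suc (suc _)))) (s≤s (s≤s (s≤s ())))

-- A relation rather than a construction, because it is applied both from a word to its
-- reverse-complement and back.
Opposite : ℕ → (π ρ : ℕ → ℕ) → Set
Opposite n π ρ = ∀ {i} → i ∈[1… n ] → ρ i ≡ rev n (π (rev n i))

InGrid : ℕ × ℕ → Set
InGrid (a , b) = a ≤ 3 × b ≤ 3

-- A half-turn of the plot reverses both chains, so ascending stays ascending and descending stays
-- descending. The point of `ρ` above `m` comes from the point of `π` above `rev n m`, and its box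
-- is moved by `opposite`.
occurrence-opposite : ∀ d {R R′ n π ρ} → Opposite n π ρ → (∀ {i} → i ∈[1… n ] → π i ∈[1… n ]) →
  (∀ {box} → box ∈ R′ → InGrid box × opposite box ∈ R) →
  ∀ {ι} → IsOccurrence d R n π ι →
  IsOccurrence d R′ n ρ (reverse (map (rev n) ι)) × reverse (map (rev n) (reverse (map (rev n) ι))) ≡ ι
occurrence-opposite d {R} {R′} {n} {π} {ρ} opp rng R′⊆
  (occurrence {i} {j} {k} {a} {b} {c} ch@(1≤i , i<j , j<k , k≤n) vals match empty) =
  occurrence (rev-chain ch) (rev-chain vals) (match′ d match) empty′ ,
  cong₂ _∷_ (rev-involutive {n} (m≤n⇒m≤1+n (proj₂ i∈)))
    (cong₂ _∷_ (rev-involutive {n} (m≤n⇒m≤1+n (proj₂ j∈)))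
      (cong₂ _∷_ (rev-involutive {n} (m≤n⇒m≤1+n (proj₂ k∈))) refl))
  where
  i∈ : i ∈[1… n ]
  i∈ = 1≤i , ≤-trans (<⇒≤ i<j) (≤-trans (<⇒≤ j<k) k≤n)
  j∈ : j ∈[1… n ]
  j∈ = ≤-trans 1≤i (<⇒≤ i<j) , ≤-trans (<⇒≤ j<k) k≤n
  k∈ : k ∈[1… n ]
  k∈ = ≤-trans 1≤i (≤-trans (<⇒≤ i<j) (<⇒≤ j<k)) , k≤n
  ρ-rev : ∀ {m} → m ∈[1… n ] → ρ (rev n m) ≡ rev n (π m)
  ρ-rev m∈@(_ , m≤n) = trans (opp (rev-range m∈)) (cong (rev n ∘ π) (rev-involutive {n} (m≤n⇒m≤1+n m≤n)))
  match′ : ∀ d → Match d π i j k a b c → Match d ρ (rev n k) (rev n j) (rev n i) (rev n c) (rev n b) (rev n a)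
  match′ inc (refl , refl , refl) = ρ-rev k∈ , ρ-rev j∈ , ρ-rev i∈
  match′ dec (refl , refl , refl) = ρ-rev k∈ , ρ-rev j∈ , ρ-rev i∈
  empty′ : Empty R′ n ρ (rev n k ∷ rev n j ∷ rev n i ∷ []) (rev n c ∷ rev n b ∷ rev n a ∷ [])
  empty′ {box} box∈ {m} m∈ (l₁ , u₁ , l₂ , u₂)
    with (p≤ , v≤) , box′∈ ← R′⊆ box∈
    = empty box′∈ (rev-range m∈)
        (proj₁ col , proj₂ col , subst (_ <_) revρ≡ (proj₁ row) , subst (_< _) revρ≡ (proj₂ row))
    where
    πm∈ = rng (rev-range m∈)
    revρ≡ : rev n (ρ m) ≡ π (rev n m)
    revρ≡ = trans (cong (rev n) (opp m∈)) (rev-involutive {n} (m≤n⇒m≤1+n (proj₂ πm∈)))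
    col = rev-between n i j k (proj₁ box) p≤ m∈ (l₁ , u₁)
    row = rev-between n a b c (proj₂ box) v≤
            (subst (_∈[1… n ]) (sym (opp m∈)) (rev-range πm∈)) (l₂ , u₂)

reverseComplement : ℕ → List ℕ → List ℕ
reverseComplement n w = word n (λ i → rev n (val w (rev n i)))

module _ {n : ℕ} {w : List ℕ} (w! : IsPermutation n w) where
  private
    I = permutation⇒Inverses w!

  reverseComplement-permutation : IsPermutation n (reverseComplement n w)
  reverseComplement-permutation = word-permutation {σ = λ v → rev n (pos w (rev n v))} record
    { π-range = rev-range ∘ π-range I ∘ rev-range
    ; σ-range = rev-range ∘ σ-range I ∘ rev-range
    ; π∘σ     = λ {v} v∈ → trans
        (cong (rev n ∘ val w) (rev-involutive {n} (m≤n⇒m≤1+n (proj₂ (σ-range I (rev-range v∈))))))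
        (trans (cong (rev n) (π∘σ I (rev-range v∈))) (rev-involutive {n} (m≤n⇒m≤1+n (proj₂ v∈))))
    ; σ∘π     = λ {v} v∈ → trans
        (cong (λ u → rev n (pos w u)) (rev-involutive {n} (m≤n⇒m≤1+n (proj₂ (π-range I (rev-range v∈))))))
        (trans (cong (rev n) (σ∘π I (rev-range v∈))) (rev-involutive {n} (m≤n⇒m≤1+n (proj₂ v∈)))) }

  reverseComplement-Opposite : Opposite n (val w) (val (reverseComplement n w))
  reverseComplement-Opposite i∈ = val-word (λ i → rev n (val w (rev n i))) i∈

  Opposite-sym : Opposite n (val (reverseComplement n w)) (val w)
  Opposite-sym {i} i∈ = sym (trans (cong (rev n) (reverseComplement-Opposite (rev-range i∈)))
    (trans (rev-involutive {n} (m≤n⇒m≤1+n (proj₂ (π-range I (subst (_∈[1… n ]) (sym ii) i∈)))))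
           (cong (val w) ii)))
    where
    ii : rev n (rev n i) ≡ i
    ii = rev-involutive {n} (m≤n⇒m≤1+n (proj₂ i∈))

  reverseComplement-involutive : reverseComplement n (reverseComplement n w) ≡ w
  reverseComplement-involutive = word-ext (length≡ w!) (λ i∈ → sym (Opposite-sym i∈))

  occ-reverseComplement : ∀ d {R R′} →
    (∀ {box} → box ∈ R′ → InGrid box × opposite box ∈ R) →
    (∀ {box} → box ∈ R → InGrid box × opposite box ∈ R′) →
    occ (q d R) w ≡ occ (q d R′) (reverseComplement n w)
  occ-reverseComplement d R′⊆ R⊆ = occ-bijection d w! reverseComplement-permutation
    (reverse ∘ map (rev n)) (reverse ∘ map (rev n))
    (occurrence-opposite d reverseComplement-Opposite (π-range I) R′⊆)
    (occurrence-opposite d Opposite-sym (π-range (permutation⇒Inverses reverseComplement-permutation)) R⊆)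

T-reverseComplement : ∀ {R R′} →
  (∀ {box} → box ∈ R′ → InGrid box × opposite box ∈ R) →
  (∀ {box} → box ∈ R → InGrid box × opposite box ∈ R′) →
  ∀ n k ℓ → T R n k ℓ ≡ T R′ n k ℓ
T-reverseComplement R′⊆ R⊆ n = T-involution n (reverseComplement n)
  (λ w! → reverseComplement-permutation w! , reverseComplement-involutive w!)
  (λ d w! → occ-reverseComplement w! d R′⊆ R⊆)
  (λ d w! → occ-reverseComplement w! d R⊆ R′⊆)

-- The orbit of the four shadings

-- The inclusions between lists of eight boxes are settled by running a decision procedure. The
-- orbit is traversed as A34 to A36 by inversion, A33 to A35 by inversion, and A35 to A36 by the
-- half-turn.
T-A34 : ∀ n k ℓ → T R-A34 n k ℓ ≡ T R-A36 n k ℓ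
T-A34 = T-inverse
  (All.lookup (from-yes (All.all? (λ box → swap box ∈? R-A34) R-A36)))
  (All.lookup (from-yes (All.all? (λ box → swap box ∈? R-A36) R-A34)))

T-A33-A35 : ∀ n k ℓ → T R-A33 n k ℓ ≡ T R-A35 n k ℓ
T-A33-A35 = T-inverse
  (All.lookup (from-yes (All.all? (λ box → swap box ∈? R-A33) R-A35)))
  (All.lookup (from-yes (All.all? (λ box → swap box ∈? R-A35) R-A33)))

T-A35 : ∀ n k ℓ → T R-A35 n k ℓ ≡ T R-A36 n k ℓ
T-A35 = T-reverseComplement
  (All.lookup (from-yes (All.all? (opposite? R-A35) R-A36)))
  (All.lookup (from-yes (All.all? (opposite? R-A36) R-A35)))
  where
  opposite? : ∀ R box → Dec (InGrid box × opposite box ∈ R)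
  opposite? R (a , b) = (a ≤? 3 ×-dec b ≤? 3) ×-dec opposite (a , b) ∈? R

T-A33 : ∀ n k ℓ → T R-A33 n k ℓ ≡ T R-A36 n k ℓ
T-A33 n k ℓ = trans (T-A33-A35 n k ℓ) (T-A35 n k ℓ)

-- Prepending a value

-- bump p renumbers 0, 1, 2, … as the naturals other than p.
bump : ℕ → ℕ → ℕ
bump zero    v       = suc v
bump (suc p) zero    = zero
bump (suc p) (suc v) = suc (bump p v)

-- The inverse of `bump p` on the naturals other than `p`; the value at `p` itself is junk.
unbump : ℕ → ℕ → ℕ
unbump zero    v       = pred v
unbump (suc p) zero    = zero
unbump (suc p) (suc v) = suc (unbump p v)

bump-mono-< : ∀ p {u v} → u < v → bump p u < bump p v
bump-mono-< zero    u<v = s≤s u<v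
bump-mono-< (suc p) {zero}  {suc v} _ = s≤s z≤n
bump-mono-< (suc p) {suc u} {suc v} (s≤s u<v) = s≤s (bump-mono-< p u<v)

bump-cancel-< : ∀ p {u v} → bump p u < bump p v → u < v
bump-cancel-< p {u} {v} lt with <-cmp u v
... | tri< u<v _ _    = u<v
... | tri≈ _ refl _   = contradiction lt (<-irrefl refl)
... | tri> _ _ v<u    = contradiction lt (<-asym (bump-mono-< p v<u))

bump-injective : ∀ p {u v} → bump p u ≡ bump p v → u ≡ v
bump-injective zero    eq = suc-injective eq
bump-injective (suc p) {zero}  {zero}  eq = refl
bump-injective (suc p) {suc u} {suc v} eq = cong suc (bump-injective p (suc-injective eq))

bump≢ : ∀ p v → bump p v ≢ p
bump≢ (suc p) (suc v) eq = bump≢ p v (suc-injective eq)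

bump-unbump : ∀ p {v} → v ≢ p → bump p (unbump p v) ≡ v
bump-unbump zero    {zero}  v≢p = contradiction refl v≢p
bump-unbump zero    {suc v} v≢p = refl
bump-unbump (suc p) {zero}  v≢p = refl
bump-unbump (suc p) {suc v} v≢p = cong suc (bump-unbump p (v≢p ∘ cong suc))

bump-below : ∀ {p v} → v < p → bump p v ≡ v
bump-below {suc p} {zero}  _         = refl
bump-below {suc p} {suc v} (s≤s v<p) = cong suc (bump-below v<p)

bump-above : ∀ {p v} → p ≤ v → bump p v ≡ suc v
bump-above {zero}  _ = refl
bump-above {suc p} {suc v} (s≤s p≤v) = cong suc (bump-above p≤v)

bump-≤ : ∀ p v → bump p v ≤ suc v
bump-≤ zero    v       = ≤-refl
bump-≤ (suc p) zero    = z≤n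
bump-≤ (suc p) (suc v) = s≤s (bump-≤ p v)

unbump-< : ∀ {n p v} → p ≤ n → v ≤ n → v ≢ p → unbump p v < n
unbump-< {n}     {zero}  {zero}  _ _ v≢p = contradiction refl v≢p
unbump-< {n}     {zero}  {suc v} _ v≤n _ = v≤n
unbump-< {suc n} {suc p} {zero}  _ _ _   = s≤s z≤n
unbump-< {suc n} {suc p} {suc v} (s≤s p≤n) (s≤s v≤n) v≢p = s≤s (unbump-< p≤n v≤n (v≢p ∘ cong suc))

bump-range : ∀ {n p v} → 1 ≤ p → v ∈[1… n ] → bump p v ∈[1… suc n ]
bump-range {p = suc p} {suc v} _ (_ , v≤n) = s≤s z≤n , s≤s (≤-trans (bump-≤ p v) v≤n)

unbump-range : ∀ {n p v} → p ∈[1… suc n ] → v ∈[1… suc n ] → v ≢ p → unbump p v ∈[1… n ]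
unbump-range {p = suc p} {suc v} (_ , s≤s p≤n) (_ , s≤s v≤n) v≢p =
  s≤s z≤n , unbump-< p≤n v≤n (v≢p ∘ cong suc)

prepend : ℕ → List ℕ → List ℕ
prepend p u = p ∷ map (bump p) u

prepend-permutation : ∀ {n p u} → p ∈[1… suc n ] → IsPermutation n u → IsPermutation (suc n) (prepend p u)
prepend-permutation {n} {p} {u} p∈ u! = isPermutation
  (cong suc (trans (length-map (bump p) u) (length≡ u!)))
  (p∈ ∷ All.map⁺ (All.map (bump-range (proj₁ p∈)) (range u!)))
  one
  where
  p∉ : p ∉ map (bump p) u
  p∉ ∈map with v , _ , eq ← ∈-map⁻ (bump p) ∈map = bump≢ p v (sym eq)
  one : ∀ {v} → v ∈[1… suc n ] → count v (prepend p u) ≡ 1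
  one {v} v∈ with v ≟ p
  ... | yes refl = trans (count-here p (map (bump p) u) refl) (cong suc (∉⇒count≡0 p (map (bump p) u) p∉))
  ... | no  v≢p  = begin
    count v (p ∷ map (bump p) u)                    ≡⟨ count-there v (map (bump p) u) v≢p ⟩
    count v (map (bump p) u)                        ≡⟨ cong (λ z → count z (map (bump p) u)) (bump-unbump p v≢p) ⟨
    count (bump p (unbump p v)) (map (bump p) u)    ≡⟨ count-map (bump p) (bump-injective p) (unbump p v) u ⟩
    count (unbump p v) u                            ≡⟨ once u! (unbump-range p∈ v∈ v≢p) ⟩
    1                                               ∎
    where open ≡-Reasoning

prepend-surjective : ∀ {n w} → IsPermutation (suc n) w →
  ∃[ p ] ∃[ u ] p ∈[1… suc n ] × IsPermutation n u × w ≡ prepend p u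
prepend-surjective {n} {[]} (isPermutation () _ _)
prepend-surjective {n} {p ∷ w} w!@(isPermutation len (p∈ ∷ rng) one) =
  p , u , p∈ , isPermutation (trans (length-map (unbump p) w) (suc-injective len)) rng′ one′ , cong (p ∷_) (sym bump-u)
  where
  u = map (unbump p) w
  p∉ : p ∉ w
  p∉ = count≡0⇒∉ p w (suc-injective (trans (sym (count-here p w refl)) (one p∈)))
  ≢p : ∀ {v} → v ∈ w → v ≢ p
  ≢p v∈ refl = p∉ v∈
  bump-u : map (bump p) u ≡ w
  bump-u = trans (sym (map-∘ w)) (map-id-local (All.tabulate (bump-unbump p ∘ ≢p)))
  rng′ : All (_∈[1… n ]) u
  rng′ = All.map⁺ (All.tabulate λ v∈ → unbump-range p∈ (All.lookup rng v∈) (≢p v∈))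
  one′ : ∀ {v} → v ∈[1… n ] → count v u ≡ 1
  one′ {v} v∈ = begin
    count v u                          ≡⟨ count-map (bump p) (bump-injective p) v u ⟨
    count (bump p v) (map (bump p) u)  ≡⟨ cong (count (bump p v)) bump-u ⟩
    count (bump p v) w                 ≡⟨ count-there (bump p v) w (bump≢ p v) ⟨
    count (bump p v) (p ∷ w)           ≡⟨ one (bump-range (proj₁ p∈) v∈) ⟩
    1                                  ∎
    where open ≡-Reasoning

-- The two sides enumerate the same words in different orders. Both lists are free of repetitions
-- and have the same members, hence they are rearrangements of each other, which is all a sum can
-- see.
S-suc : ∀ n → S (suc n) ↭ cartesianProductWith (λ u p → prepend p u) (S n) (oneTo (suc n))
S-suc n = ∼bag⇒↭ (unique∧set⇒bag (S-unique (suc n))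
  (Unique.cartesianProductWith⁺ (λ u p → prepend p u) injective (S-unique n) (oneTo-unique (suc n)))
  (mk⇔ to from))
  where
  injective : ∀ {u u′ p p′} → prepend p u ≡ prepend p′ u′ → u ≡ u′ × p ≡ p′
  injective {p = p} eq with refl , eq′ ← ∷-injective eq = map-injective (bump-injective p) eq′ , refl
  to : ∀ {w} → w ∈ S (suc n) → w ∈ cartesianProductWith (λ u p → prepend p u) (S n) (oneTo (suc n))
  to {w} w∈ with p , u , p∈ , u! , refl ← prepend-surjective (∈-S⁻ {suc n} {w} w∈) =
    ∈-cartesianProductWith⁺ (λ u p → prepend p u) (∈-S⁺ u!) (∈-oneTo⁺ p∈)
  from : ∀ {w} → w ∈ cartesianProductWith (λ u p → prepend p u) (S n) (oneTo (suc n)) → w ∈ S (suc n)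
  from {w} w∈
    with u , p , u∈ , p∈ , refl ← ∈-cartesianProductWith⁻ (λ u p → prepend p u) (S n) (oneTo (suc n)) w∈ =
    ∈-S⁺ (prepend-permutation (∈-oneTo⁻ p∈) (∈-S⁻ {n} {u} u∈))

at-map : ∀ (f : ℕ → ℕ) w {i} → i < length w → at (map f w) i ≡ f (at w i)
at-map f (x ∷ w) {zero}  _        = refl
at-map f (x ∷ w) {suc i} (s≤s i<) = at-map f w i<

val-prepend : ∀ {n p u} → length u ≡ n → ∀ {i} → i ∈[1… n ] → val (prepend p u) (suc i) ≡ bump p (val u i)
val-prepend {p = p} {u} refl {suc i} (_ , i<) = at-map (bump p) u i<

-- The bound `1 ≤ proj₁ box` records that column 0 is unshaded, on which the whole prepending
-- argument rests.
A36-grid : ∀ {box} → box ∈ R-A36 → 1 ≤ proj₁ box × proj₁ box ≤ 3 × proj₂ box ≤ 3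
A36-grid = All.lookup (from-yes (All.all? (λ (a , b) → (1 ≤? a) ×-dec ((a ≤? 3) ×-dec (b ≤? 3))) R-A36))

-- From column 1 on, both bounding lines move right by one. Column 0 would behave differently: its
-- left line stays at 0, and it takes in the new entry.
between-suc⁺ : ∀ n i j k a {m} → 1 ≤ a → a ≤ 3 → Between n (i ∷ j ∷ k ∷ []) a m →
               Between (suc n) (suc i ∷ suc j ∷ suc k ∷ []) a (suc m)
between-suc⁺ n i j k 1 _ _ (l , u) = s≤s l , s≤s u
between-suc⁺ n i j k 2 _ _ (l , u) = s≤s l , s≤s u
between-suc⁺ n i j k 3 _ _ (l , u) = s≤s l , s≤s u
between-suc⁺ n i j k (suc (suc (suc (suc _)))) _ (s≤s (s≤s (s≤s ())))

-- A position in columns 1 to 3 is to the right of `suc i`, so it is not the prepended one and comes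
-- from a genuine position of the old word.
between-suc⁻ : ∀ n i j k a {m} → 1 ≤ i → i < j → j < k → 1 ≤ a → a ≤ 3 →
               Between (suc n) (suc i ∷ suc j ∷ suc k ∷ []) a m →
               ∃[ m′ ] m ≡ suc m′ × 1 ≤ m′ × Between n (i ∷ j ∷ k ∷ []) a m′
between-suc⁻ n i j k 1 {suc m} 1≤i _ _ _ _ (s≤s l , s≤s u) = m , refl , ≤-trans 1≤i (<⇒≤ l) , l , u
between-suc⁻ n i j k 2 {suc m} 1≤i i<j _ _ _ (s≤s l , s≤s u) =
  m , refl , ≤-trans 1≤i (<⇒≤ (<-trans i<j l)) , l , u
between-suc⁻ n i j k 3 {suc m} 1≤i i<j j<k _ _ (s≤s l , s≤s u) =
  m , refl , ≤-trans 1≤i (<⇒≤ (<-trans i<j (<-trans j<k l))) , l , u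
between-suc⁻ n i j k (suc (suc (suc (suc _)))) _ _ _ _ (s≤s (s≤s (s≤s ())))

cut-bump : ∀ {n p} a b c → p ∈[1… suc n ] → ∀ r → r ≤ 4 →
           cut (suc n) (bump p a ∷ bump p b ∷ bump p c ∷ []) r ≡ bump p (cut n (a ∷ b ∷ c ∷ []) r)
cut-bump {p = suc p} a b c _ 0 _ = refl
cut-bump a b c _ 1 _ = refl
cut-bump a b c _ 2 _ = refl
cut-bump a b c _ 3 _ = refl
cut-bump a b c (_ , p≤) 4 _ = sym (bump-above p≤)
cut-bump a b c _ (suc (suc (suc (suc (suc _))))) (s≤s (s≤s (s≤s (s≤s ()))))

module _ {n p a b c : ℕ} (p∈ : p ∈[1… suc n ]) {r : ℕ} (r≤3 : r ≤ 3) {v : ℕ} where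
  between-bump⁺ : Between n (a ∷ b ∷ c ∷ []) r v →
                  Between (suc n) (bump p a ∷ bump p b ∷ bump p c ∷ []) r (bump p v)
  between-bump⁺ (l , u) =
    subst (_< bump p v) (sym (cut-bump a b c p∈ r (m≤n⇒m≤1+n r≤3))) (bump-mono-< p l) ,
    subst (bump p v <_) (sym (cut-bump a b c p∈ (suc r) (s≤s r≤3))) (bump-mono-< p u)

  between-bump⁻ : Between (suc n) (bump p a ∷ bump p b ∷ bump p c ∷ []) r (bump p v) →
                  Between n (a ∷ b ∷ c ∷ []) r v
  between-bump⁻ (l , u) =
    bump-cancel-< p (subst (_< bump p v) (cut-bump a b c p∈ r (m≤n⇒m≤1+n r≤3)) l) ,
    bump-cancel-< p (subst (bump p v <_) (cut-bump a b c p∈ (suc r) (s≤s r≤3)) u)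

chain-range : ∀ {n i j k} → Chain n i j k → i ∈[1… n ] × j ∈[1… n ] × k ∈[1… n ]
chain-range (1≤i , i<j , j<k , k≤n) =
  (1≤i , ≤-trans (<⇒≤ i<j) (≤-trans (<⇒≤ j<k) k≤n)) ,
  (≤-trans 1≤i (<⇒≤ i<j) , ≤-trans (<⇒≤ j<k) k≤n) ,
  (≤-trans 1≤i (≤-trans (<⇒≤ i<j) (<⇒≤ j<k)) , k≤n)

module _ {n p : ℕ} {u : List ℕ} (p∈ : p ∈[1… suc n ]) (u! : IsPermutation n u) where

  private
    π = val u
    ρ = val (prepend p u)
    ρ-suc : ∀ {i} → i ∈[1… n ] → ρ (suc i) ≡ bump p (π i)
    ρ-suc = val-prepend (length≡ u!)

  -- The prepended point falls into column 0, where nothing is shaded; every other point keeps its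
  -- box relative to the three chosen ones.
  shift-occurrence : ∀ d {ι} → IsOccurrence d R-A36 n π ι → IsOccurrence d R-A36 (suc n) ρ (map suc ι)
  shift-occurrence d (occurrence {i} {j} {k} {a} {b} {c} ch@(1≤i , i<j , j<k , k≤n) (1≤a , a<b , b<c , c≤n) match empty)
    with i∈ , j∈ , k∈ ← chain-range ch
    = occurrence (s≤s z≤n , s≤s i<j , s≤s j<k , s≤s k≤n)
        (proj₁ (bump-range (proj₁ p∈) (1≤a , ≤-trans (<⇒≤ a<b) (≤-trans (<⇒≤ b<c) c≤n))) ,
         bump-mono-< p a<b , bump-mono-< p b<c ,
         proj₂ (bump-range (proj₁ p∈) (≤-trans 1≤a (≤-trans (<⇒≤ a<b) (<⇒≤ b<c)) , c≤n)))
        (match′ d match) empty′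
    where
    match′ : ∀ d → Match d π i j k a b c → Match d ρ (suc i) (suc j) (suc k) (bump p a) (bump p b) (bump p c)
    match′ inc (refl , refl , refl) = let i∈ , j∈ , k∈ = chain-range ch in ρ-suc i∈ , ρ-suc j∈ , ρ-suc k∈
    match′ dec (refl , refl , refl) = let i∈ , j∈ , k∈ = chain-range ch in ρ-suc i∈ , ρ-suc j∈ , ρ-suc k∈
    empty′ : Empty R-A36 (suc n) ρ (suc i ∷ suc j ∷ suc k ∷ []) (bump p a ∷ bump p b ∷ bump p c ∷ [])
    empty′ {box} box∈ {m} (_ , m≤) (l₁ , u₁ , l₂ , u₂)
      with 1≤x , x≤3 , y≤3 ← A36-grid box∈
      with m′ , refl , 1≤m′ , l₁′ , u₁′ ← between-suc⁻ n i j k (proj₁ box) {m} 1≤i i<j j<k 1≤x x≤3 (l₁ , u₁)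
      with l₂′ , u₂′ ← between-bump⁻ {n} {p} {a} {b} {c} p∈ y≤3
             (subst (_ <_) (ρ-suc (1≤m′ , s≤s⁻¹ m≤)) l₂ , subst (_< _) (ρ-suc (1≤m′ , s≤s⁻¹ m≤)) u₂)
      = empty box∈ (1≤m′ , s≤s⁻¹ m≤) (l₁′ , u₁′ , l₂′ , u₂′)

  match-unshift : ∀ d {i j k a b c} → i ∈[1… n ] → j ∈[1… n ] → k ∈[1… n ] →
    Match d ρ (suc i) (suc j) (suc k) a b c →
    ∃[ a′ ] ∃[ b′ ] ∃[ c′ ] Match d π i j k a′ b′ c′ × 1 ≤ a′ × c′ ≤ n ×
      a ≡ bump p a′ × b ≡ bump p b′ × c ≡ bump p c′
  match-unshift inc i∈ j∈ k∈ (refl , refl , refl) =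
    _ , _ , _ , (refl , refl , refl) , proj₁ (π-range I i∈) , proj₂ (π-range I k∈) ,
    ρ-suc i∈ , ρ-suc j∈ , ρ-suc k∈
    where I = permutation⇒Inverses u!
  match-unshift dec i∈ j∈ k∈ (refl , refl , refl) =
    _ , _ , _ , (refl , refl , refl) , proj₁ (π-range I k∈) , proj₂ (π-range I i∈) ,
    ρ-suc k∈ , ρ-suc j∈ , ρ-suc i∈
    where I = permutation⇒Inverses u!

  unshift-occurrence : ∀ d {i j k} → 1 ≤ i →
    IsOccurrence d R-A36 (suc n) ρ (suc i ∷ suc j ∷ suc k ∷ []) → IsOccurrence d R-A36 n π (i ∷ j ∷ k ∷ [])
  unshift-occurrence d {i} {j} {k} 1≤i
    (occurrence (_ , s≤s i<j , s≤s j<k , s≤s k≤n) (_ , a<b , b<c , _) match empty)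
    with i∈ , j∈ , k∈ ← chain-range (1≤i , i<j , j<k , k≤n)
    with a , b , c , match′ , 1≤a , c≤n , refl , refl , refl ← match-unshift d i∈ j∈ k∈ match
    = occurrence (1≤i , i<j , j<k , k≤n) (1≤a , bump-cancel-< p a<b , bump-cancel-< p b<c , c≤n) match′
        λ { {box} box∈ {m} m∈@(1≤m , m≤n) (l₁ , u₁ , l₂ , u₂) →
          let 1≤x , x≤3 , y≤3 = A36-grid box∈
              l₁′ , u₁′ = between-suc⁺ n i j k (proj₁ box) 1≤x x≤3 (l₁ , u₁)
              l₂′ , u₂′ = between-bump⁺ {n} {p} {a} {b} {c} p∈ y≤3 (l₂ , u₂)
          in empty box∈ (s≤s z≤n , s≤s m≤n)
               (l₁′ , u₁′ , subst (_ <_) (sym (ρ-suc m∈)) l₂′ , subst (_< _) (sym (ρ-suc m∈)) u₂′) }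

-- Occurrences at the first position

On : (v a b c : ℕ) → Set
On v a b c = v ≡ a ⊎ v ≡ b ⊎ v ≡ c

-- Used for positions and for values alike: a coordinate off the three lines of an occurrence
-- determines a strip, and with it a box to test for shading.
locate : ∀ {n a b c v} → v ∈[1… n ] → ¬ On v a b c → ∃[ r ] r ≤ 3 × Between n (a ∷ b ∷ c ∷ []) r v
locate {n} {a} {b} {c} {v} (1≤v , v≤n) v∉ with <-cmp v a | <-cmp v b | <-cmp v c
... | tri≈ _ eq _   | _             | _             = contradiction (inj₁ eq) v∉
... | _             | tri≈ _ eq _   | _             = contradiction (inj₂ (inj₁ eq)) v∉
... | _             | _             | tri≈ _ eq _   = contradiction (inj₂ (inj₂ eq)) v∉
... | tri< v<a _ _  | _             | _             = 0 , z≤n , 1≤v , v<a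
... | tri> _ _ a<v  | tri< v<b _ _  | _             = 1 , s≤s z≤n , a<v , v<b
... | tri> _ _ _    | tri> _ _ b<v  | tri< v<c _ _  = 2 , s≤s (s≤s z≤n) , b<v , v<c
... | tri> _ _ _    | tri> _ _ _    | tri> _ _ c<v  = 3 , ≤-refl , c<v , s≤s v≤n

module _ {N : ℕ} {π σ : ℕ → ℕ} (I : Inverses N π σ) where

  -- A permutation has one point on each line, so a point whose value belongs to the occurrence is
  -- itself a point of the occurrence.
  on-position : ∀ d {i j k a b c m} → Chain N i j k → Match d π i j k a b c → m ∈[1… N ] →
                On (π m) a b c → On m i j k
  on-position d ch match m∈ on with i∈ , j∈ , k∈ ← chain-range ch = go d match on
    where
    inj : ∀ {x y} → x ∈[1… N ] → y ∈[1… N ] → π x ≡ π y → x ≡ y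
    inj x∈ y∈ eq = trans (sym (σ∘π I x∈)) (trans (cong σ eq) (σ∘π I y∈))
    go : ∀ d → Match d π _ _ _ _ _ _ → On (π _) _ _ _ → On _ _ _ _
    go inc (refl , refl , refl) (inj₁ eq)        = inj₁ (inj m∈ i∈ eq)
    go inc (refl , refl , refl) (inj₂ (inj₁ eq)) = inj₂ (inj₁ (inj m∈ j∈ eq))
    go inc (refl , refl , refl) (inj₂ (inj₂ eq)) = inj₂ (inj₂ (inj m∈ k∈ eq))
    go dec (refl , refl , refl) (inj₁ eq)        = inj₂ (inj₂ (inj m∈ k∈ eq))
    go dec (refl , refl , refl) (inj₂ (inj₁ eq)) = inj₂ (inj₁ (inj m∈ j∈ eq))
    go dec (refl , refl , refl) (inj₂ (inj₂ eq)) = inj₁ (inj m∈ i∈ eq)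

  on-value : ∀ d {i j k a b c m} → Match d π i j k a b c → On m i j k → On (π m) a b c
  on-value inc (refl , refl , refl) (inj₁ refl)        = inj₁ refl
  on-value inc (refl , refl , refl) (inj₂ (inj₁ refl)) = inj₂ (inj₁ refl)
  on-value inc (refl , refl , refl) (inj₂ (inj₂ refl)) = inj₂ (inj₂ refl)
  on-value dec (refl , refl , refl) (inj₁ refl)        = inj₂ (inj₂ refl)
  on-value dec (refl , refl , refl) (inj₂ (inj₁ refl)) = inj₂ (inj₁ refl)
  on-value dec (refl , refl , refl) (inj₂ (inj₂ refl)) = inj₁ refl

  module _ (d : Direction) {j k a b c : ℕ} (ch : Chain N 1 j k) (vals : Chain N a b c) (match : Match d π 1 j k a b c)
           (empty : Empty R-A36 N π (1 ∷ j ∷ k ∷ []) (a ∷ b ∷ c ∷ [])) where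

    private
      1<j = proj₁ (proj₂ ch)
      j<k = proj₁ (proj₂ (proj₂ ch))
      k≤N = proj₂ (proj₂ (proj₂ ch))
      1≤a = proj₁ vals
      a<b = proj₁ (proj₂ vals)
      b<c = proj₁ (proj₂ (proj₂ vals))
      c≤N = proj₂ (proj₂ (proj₂ vals))

      column₁ : ∀ {r} → r ≤ 3 → (1 , r) ∈ R-A36
      column₁ {0} _ = here refl
      column₁ {1} _ = there (here refl)
      column₁ {2} _ = there (there (here refl))
      column₁ {3} _ = there (there (there (here refl)))
      column₁ {suc (suc (suc (suc _)))} (s≤s (s≤s (s≤s ())))

      2-isolated : 2 < j → ¬ On 2 1 j k
      2-isolated 2<j (inj₂ (inj₁ 2≡j)) = <⇒≢ 2<j 2≡j
      2-isolated 2<j (inj₂ (inj₂ 2≡k)) = <⇒≢ (<-trans 2<j j<k) 2≡k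

    -- Otherwise position 2 is strictly between positions 1 and `j`, and whatever the row of its
    -- entry, the box in column 1 is shaded.
    first-second : j ≡ 2
    first-second with j ≟ 2
    ... | yes j≡2 = j≡2
    ... | no  j≢2 = contradiction (≤∧≢⇒< 1<j (j≢2 ∘ sym)) 2≮j
      where
      2≮j : ¬ 2 < j
      2≮j 2<j with 2∈ ← s≤s z≤n , ≤-trans (<⇒≤ 2<j) (≤-trans (<⇒≤ j<k) k≤N)
              with r , r≤3 , l , u ← locate (π-range I 2∈) (2-isolated 2<j ∘ on-position d ch match 2∈)
              = empty (column₁ r≤3) 2∈ (≤-refl , 2<j , l , u)

    private
      -- v would have to occur after position 2, in the shaded box of column 2 or 3
      missed : ∀ {v r} → (2 , r) ∈ R-A36 → (3 , r) ∈ R-A36 → v ∈[1… N ] →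
               Between N (a ∷ b ∷ c ∷ []) r v → ¬ ¬ On v a b c
      missed {v} {r} 2r∈ 3r∈ v∈ (l , u) v∉ with first-second
      ... | refl with locate (σ-range I v∈) off
        where
        off : ¬ On (σ v) 1 j k
        off on = v∉ (subst (λ v → On v a b c) (π∘σ I v∈) (on-value d match on))
      ...   | 0 , _ , 0<m , m<1 = contradiction m<1 (≤⇒≯ 0<m)
      ...   | 1 , _ , 1<m , m<2 = contradiction m<2 (≤⇒≯ 1<m)
      ...   | 2 , _ , l′ , u′   = empty 2r∈ (σ-range I v∈)
        (l′ , u′ , subst (_ <_) (sym (π∘σ I v∈)) l , subst (_< _) (sym (π∘σ I v∈)) u)
      ...   | 3 , _ , l′ , u′   = empty 3r∈ (σ-range I v∈)
        (l′ , u′ , subst (_ <_) (sym (π∘σ I v∈)) l , subst (_< _) (sym (π∘σ I v∈)) u)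
      ...   | suc (suc (suc (suc _))) , s≤s (s≤s (s≤s ())) , _

    -- Otherwise the value 1 lies in row 0, and the boxes (2 , 0) and (3 , 0) leave it no place.
    first-minimum : a ≡ 1
    first-minimum with a ≟ 1
    ... | yes a≡1 = a≡1
    ... | no  a≢1 = contradiction off
        (missed (there (there (there (there (here refl))))) (there (there (there (there (there (there (here refl)))))))
          (≤-refl , ≤-trans 1≤a (≤-trans (<⇒≤ a<b) (≤-trans (<⇒≤ b<c) c≤N))) (≤-refl , 1<a))
      where
      1<a = ≤∧≢⇒< 1≤a (a≢1 ∘ sym)
      off : ¬ On 1 a b c
      off (inj₁ eq)        = <⇒≢ 1<a eq
      off (inj₂ (inj₁ eq)) = <⇒≢ (<-trans 1<a a<b) eq
      off (inj₂ (inj₂ eq)) = <⇒≢ (<-trans 1<a (<-trans a<b b<c)) eq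

    -- Otherwise the value `suc b` lies in row 2, and the boxes (2 , 2) and (3 , 2) leave it no
    -- place.
    first-adjacent : c ≡ suc b
    first-adjacent with c ≟ suc b
    ... | yes c≡ = c≡
    ... | no  c≢ = contradiction off
        (missed (there (there (there (there (there (here refl))))))
          (there (there (there (there (there (there (there (here refl))))))))
          (s≤s z≤n , ≤-trans b<c c≤N) (≤-refl , sb<c))
      where
      sb<c = ≤∧≢⇒< b<c (c≢ ∘ sym)
      off : ¬ On (suc b) a b c
      off (inj₁ eq)        = <⇒≢ (<-trans a<b ≤-refl) (sym eq)
      off (inj₂ (inj₁ eq)) = 1+n≢n eq
      off (inj₂ (inj₂ eq)) = c≢ (sym eq)

-- Each shaded box is bounded by two consecutive integers: positions 1 and 2 for column 1, values 0
-- and 1 for row 0, values `b` and `suc b` for row 2.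
first-empty : ∀ {N π k b} → Empty R-A36 N π (1 ∷ 2 ∷ k ∷ []) (1 ∷ b ∷ suc b ∷ [])
first-empty (here refl)                         _ (l , u , _) = ≤⇒≯ l u
first-empty (there (here refl))                 _ (l , u , _) = ≤⇒≯ l u
first-empty (there (there (here refl)))         _ (l , u , _) = ≤⇒≯ l u
first-empty (there (there (there (here refl)))) _ (l , u , _) = ≤⇒≯ l u
first-empty (there (there (there (there (here refl))))) _ (_ , _ , l , u) = ≤⇒≯ l u
first-empty (there (there (there (there (there (here refl)))))) _ (_ , _ , l , u) = ≤⇒≯ l u
first-empty (there (there (there (there (there (there (here refl))))))) _ (_ , _ , l , u) = ≤⇒≯ l u
first-empty (there (there (there (there (there (there (there (here refl)))))))) _ (_ , _ , l , u) = ≤⇒≯ l u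

-- The occurrence created by a new first entry

-- For 123 the new entry is the minimum 1, `f` is raised to f + 1, and the third value f + 2 must
-- not exceed n + 1. For 321 the new entry is one above `f`, which stays unraised, and the third
-- value 1 must differ from `f`.
IsNew : Direction → (n p f : ℕ) → Set
IsNew inc n p f = p ≡ 1 × f ≢ n
IsNew dec n p f = p ≡ suc f × f ≢ 1

new? : ∀ d n p f → Dec (IsNew d n p f)
new? inc n p f = (p ≟ 1) ×-dec ¬? (f ≟ n)
new? dec n p f = (p ≟ suc f) ×-dec ¬? (f ≟ 1)

new : Direction → (n p f : ℕ) → ℕ
new d n p f with new? d n p f
... | yes _ = 1
... | no  _ = 0

-- The third value is the largest for 123, one above the middle one, and the smallest for 321,
-- namely 1.
new-third : Direction → List ℕ → ℕ
new-third inc w = pos w (suc (val w 2))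
new-third dec w = pos w 1

new-triple : Direction → List ℕ → List ℕ
new-triple d w = 1 ∷ 2 ∷ new-third d w ∷ []

module _ {n p : ℕ} {u : List ℕ} (1≤n : 1 ≤ n) (p∈ : p ∈[1… suc n ]) (u! : IsPermutation n u) where

  private
    w  = prepend p u
    w! = prepend-permutation p∈ u!
    I  = permutation⇒Inverses w!
    f  = val u 1
    f∈ : f ∈[1… n ]
    f∈ = π-range (permutation⇒Inverses u!) (≤-refl , 1≤n)
    w₂ : val w 2 ≡ bump p f
    w₂ = val-prepend {u = u} (length≡ u!) (≤-refl , 1≤n)
    1∈ : 1 ∈[1… suc n ]
    1∈ = ≤-refl , s≤s z≤n
    2∈ : 2 ∈[1… suc n ]
    2∈ = s≤s z≤n , s≤s 1≤n

    >2 : ∀ {k} → 1 ≤ k → k ≢ 1 → k ≢ 2 → 2 < k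
    >2 1≤k k≢1 k≢2 = ≤∧≢⇒< (≤∧≢⇒< 1≤k (k≢1 ∘ sym)) (k≢2 ∘ sym)

  first⇒new : ∀ d {j k} → IsOccurrence d R-A36 (suc n) (val w) (1 ∷ j ∷ k ∷ []) →
              IsNew d n p f × 1 ∷ j ∷ k ∷ [] ≡ new-triple d w
  first⇒new d {j} {k} (occurrence {a = a} {b} {c} ch vals@(_ , a<b , _ , c≤) match empty)
    with refl ← first-second I d ch vals match empty
       | refl ← first-minimum I d ch vals match empty
       | refl ← first-adjacent I d ch vals match empty
    = go d match
    where
    k∈ = proj₂ (proj₂ (chain-range ch))
    go : ∀ d → Match d (val w) 1 2 k 1 b (suc b) → IsNew d n p f × 1 ∷ 2 ∷ k ∷ [] ≡ new-triple d w
    go inc (refl , refl , wk≡) = (refl , f≢n) , cong (λ k → 1 ∷ 2 ∷ k ∷ [])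
        (trans (sym (σ∘π I k∈)) (cong (pos w) wk≡))
      where
      f≢n : f ≢ n
      -- Since `p` is 1, the second entry is `suc f`, so the bound on the third value reads f + 2 ≤
      -- n + 1.
      f≢n f≡n = 1+n≰n (subst (λ v → suc v ≤ suc n) (trans w₂ (trans (bump-above (proj₁ f∈)) (cong suc f≡n))) c≤)
    go dec (p≡ , refl , wk≡) = (p≡suc , f≢1) , cong (λ k → 1 ∷ 2 ∷ k ∷ [])
        (trans (sym (σ∘π I k∈)) (cong (pos w) wk≡))
      where
      bump< : bump p f < p
      bump< = ≤-reflexive (trans (cong suc (sym w₂)) (sym p≡))
      f<p : f < p
      -- If `p ≤ f`, then `f` is raised to `suc f`, which contradicts the descent from the first
      -- entry to the second.
      f<p = ≰⇒> λ p≤f → <⇒≱ bump<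
        (≤-trans p≤f (≤-trans (n≤1+n f) (≤-reflexive (sym (bump-above p≤f)))))
      w₂≡f : val w 2 ≡ f
      w₂≡f = trans w₂ (bump-below f<p)
      p≡suc : p ≡ suc f
      p≡suc = trans p≡ (cong suc w₂≡f)
      f≢1 : f ≢ 1
      f≢1 f≡1 = <⇒≢ a<b (sym (trans w₂≡f f≡1))

  new⇒first : ∀ d → IsNew d n p f → IsOccurrence d R-A36 (suc n) (val w) (new-triple d w)
  new⇒first inc (refl , f≢n) = occurrence
    (≤-refl , ≤-refl , >2 (proj₁ k∈) k≢1 k≢2 , proj₂ k∈)
    (≤-refl , subst (1 <_) (sym w₂≡) (s≤s (proj₁ f∈)) , ≤-refl , proj₂ c∈)
    (refl , refl , wk≡) first-empty
    where
    w₂≡ : val w 2 ≡ suc f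
    w₂≡ = trans w₂ (bump-above (proj₁ f∈))
    c∈ : suc (val w 2) ∈[1… suc n ]
    -- The condition `f ≢ n` is what keeps the value f + 2 inside the range.
    c∈ = s≤s z≤n , subst (λ v → suc v ≤ suc n) (sym w₂≡) (s≤s (≤∧≢⇒< (proj₂ f∈) f≢n))
    k∈ = σ-range I c∈
    wk≡ : val w (new-third inc w) ≡ suc (val w 2)
    wk≡ = π∘σ I c∈
    k≢1 : new-third inc w ≢ 1
    k≢1 k≡1 = contradiction (trans (cong (val w) (sym k≡1)) wk≡) (<⇒≢ (s≤s (subst (1 ≤_) (sym w₂≡) (s≤s z≤n))))
    k≢2 : new-third inc w ≢ 2
    k≢2 k≡2 = 1+n≢n (sym (trans (cong (val w) (sym k≡2)) wk≡))
  new⇒first dec (p≡ , f≢1) = occurrence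
    (≤-refl , ≤-refl , >2 (proj₁ k∈) k≢1 k≢2 , proj₂ k∈)
    (≤-refl , subst (1 <_) (sym w₂≡) 1<f , ≤-refl , subst (λ v → suc v ≤ suc n) (sym w₂≡) (s≤s (proj₂ f∈)))
    (trans p≡ (cong suc (sym w₂≡)) , refl , wk≡) first-empty
    where
    1<f : 1 < f
    1<f = ≤∧≢⇒< (proj₁ f∈) (f≢1 ∘ sym)
    w₂≡ : val w 2 ≡ f
    w₂≡ = trans w₂ (bump-below (≤-reflexive (sym p≡)))
    k∈ = σ-range I 1∈
    wk≡ : val w (new-third dec w) ≡ 1
    wk≡ = π∘σ I 1∈
    k≢1 : new-third dec w ≢ 1
    k≢1 k≡1 = <⇒≢ (<-trans 1<f (≤-reflexive (sym p≡))) (sym (trans (cong (val w) (sym k≡1)) wk≡))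
    k≢2 : new-third dec w ≢ 2
    k≢2 k≡2 = <⇒≢ 1<f (sym (trans (sym w₂≡) (trans (cong (val w) (sym k≡2)) wk≡)))

  -- Occurrences in `w` are split by whether they use position 1; those that do not are the shifted
  -- occurrences in `u`. The list `new` enumerates those that do and will have one member or none.
  occ-split : ∀ d new → Unique new →
    (∀ {j k} → IsOccurrence d R-A36 (suc n) (val w) (1 ∷ j ∷ k ∷ []) → 1 ∷ j ∷ k ∷ [] ∈ new) →
    (∀ {ι} → ι ∈ new → ∃[ j ] ∃[ k ] ι ≡ 1 ∷ j ∷ k ∷ [] × IsOccurrence d R-A36 (suc n) (val w) ι) →
    occ (q d R-A36) w ≡ length new ℕ.+ occ (q d R-A36) u
  occ-split d new new! complete sound = begin
    occ (q d R-A36) w                                      ≡⟨ occ-occurrences d R-A36 w ⟩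
    length (occurrences d R-A36 w)                         ≡⟨ bijection-length id id (occurrences-unique d R-A36 w)
      (Unique.++⁺ new! (Unique.map⁺ (map-injective suc-injective) (occurrences-unique d R-A36 u)) disjoint)
      (λ ι∈ → to ι∈ , refl) (λ ι∈ → from ι∈ , refl) ⟩
    length (new ++ map (map suc) (occurrences d R-A36 u))  ≡⟨ length-++ new ⟩
    length new ℕ.+ length (map (map suc) (occurrences d R-A36 u))
      ≡⟨ cong (λ m → length new ℕ.+ m) (length-map (map suc) (occurrences d R-A36 u)) ⟩
    length new ℕ.+ length (occurrences d R-A36 u)            ≡⟨ cong (λ m → length new ℕ.+ m) (occ-occurrences d R-A36 u) ⟨
    length new ℕ.+ occ (q d R-A36) u                         ∎
    where
    open ≡-Reasoning
    disjoint : ∀ {ι} → ¬ (ι ∈ new × ι ∈ map (map suc) (occurrences d R-A36 u))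
    disjoint (ι∈new , ι∈)
      with _ , _ , refl , _ ← sound ι∈new
      with ι′ , ι′∈ , eq ← ∈-map⁻ (map suc) ι∈
      with occurrence (1≤i , _) _ _ _ ← ∈-occurrences⁻ d {w = u} u! ι′∈
      = <⇒≢ (s≤s 1≤i) (proj₁ (∷-injective eq))
    to : ∀ {ι} → ι ∈ occurrences d R-A36 w → ι ∈ new ++ map (map suc) (occurrences d R-A36 u)
    to ι∈ with ∈-occurrences⁻ d {w = w} w! ι∈
    ... | o@(occurrence {suc zero} _ _ _ _) = ∈-++⁺ˡ (complete o)
    ... | o@(occurrence {suc (suc i)} {suc j} {suc k} _ _ _ _) =
      ∈-++⁺ʳ new (∈-map⁺ (map suc) (∈-occurrences⁺ d {w = u} u! (unshift-occurrence p∈ u! d (s≤s z≤n) o)))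
    ... | occurrence {suc _} {suc _} {zero} (_ , _ , () , _) _ _ _
    from : ∀ {ι} → ι ∈ new ++ map (map suc) (occurrences d R-A36 u) → ι ∈ occurrences d R-A36 w
    from ι∈ with ∈-++⁻ new ι∈
    ... | inj₁ ι∈new = let _ , _ , _ , o = sound ι∈new in ∈-occurrences⁺ d {w = w} w! o
    ... | inj₂ ι∈map with ι′ , ι′∈ , refl ← ∈-map⁻ (map suc) ι∈map =
      ∈-occurrences⁺ d {w = w} w! (shift-occurrence p∈ u! d (∈-occurrences⁻ d {w = u} u! ι′∈))

  occ-prepend : ∀ d → occ (q d R-A36) w ≡ new d n p f ℕ.+ occ (q d R-A36) u
  occ-prepend d with new? d n p f
  ... | yes isNew = occ-split d [ new-triple d w ] ([] ∷ [])
          (λ o → here (proj₂ (first⇒new d o)))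
          λ { (here refl) → _ , _ , refl , new⇒first d isNew }
  ... | no ¬new = occ-split d [] [] (λ o → contradiction (proj₁ (first⇒new d o)) ¬new) λ ()

-- Weighted sums over permutations

∑ : (A → ℤ) → List A → ℤ
∑ g []       = 0ℤ
∑ g (x ∷ xs) = g x + ∑ g xs

∑-cong : ∀ {g h : A → ℤ} xs → (∀ {x} → x ∈ xs → g x ≡ h x) → ∑ g xs ≡ ∑ h xs
∑-cong []       eq = refl
∑-cong (x ∷ xs) eq = cong₂ _+_ (eq (here refl)) (∑-cong xs (eq ∘ there))

∑-++ : ∀ (g : A → ℤ) xs ys → ∑ g (xs ++ ys) ≡ ∑ g xs + ∑ g ys
∑-++ g []       ys = sym (ℤ.+-identityˡ (∑ g ys))
∑-++ g (x ∷ xs) ys = trans (cong (λ s → g x + s) (∑-++ g xs ys)) (sym (ℤ.+-assoc (g x) (∑ g xs) (∑ g ys)))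

∑-map : ∀ (g : B → ℤ) (f : A → B) xs → ∑ g (map f xs) ≡ ∑ (g ∘ f) xs
∑-map g f []       = refl
∑-map g f (x ∷ xs) = cong (λ s → g (f x) + s) (∑-map g f xs)

∑-↭ : ∀ (g : A → ℤ) {xs ys} → xs ↭ ys → ∑ g xs ≡ ∑ g ys
∑-↭ g ↭.refl         = refl
∑-↭ g (↭.prep x p)   = cong (λ s → g x + s) (∑-↭ g p)
∑-↭ g (↭.swap x y p) = trans (exchange (g x) (g y) _) (cong (λ s → g y + (g x + s)) (∑-↭ g p))
  where
  exchange : ∀ a b s → a + (b + s) ≡ b + (a + s)
  exchange = solve-∀
∑-↭ g (↭.trans p p′) = trans (∑-↭ g p) (∑-↭ g p′)

∑-cartesianProductWith : ∀ (g : C → ℤ) (f : A → B → C) xs ys →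
  ∑ g (cartesianProductWith f xs ys) ≡ ∑ (λ x → ∑ (λ y → g (f x y)) ys) xs
∑-cartesianProductWith g f []       ys = refl
∑-cartesianProductWith g f (x ∷ xs) ys = trans (∑-++ g (map (f x) ys) _)
  (cong₂ _+_ (∑-map g (f x) ys) (∑-cartesianProductWith g f xs ys))

∑-S-suc : ∀ (g : List ℕ → ℤ) n →
          ∑ g (S (suc n)) ≡ ∑ (λ u → ∑ (λ p → g (prepend p u)) (oneTo (suc n))) (S n)
∑-S-suc g n = trans (∑-↭ g (S-suc n)) (∑-cartesianProductWith g (λ u p → prepend p u) (S n) (oneTo (suc n)))

ind : ℕ → ℕ → ℤ
ind m n = if m ≡ᵇ n then 1ℤ else 0ℤ

ind-yes : ∀ {m n} → m ≡ n → ind m n ≡ 1ℤ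
ind-yes eq rewrite ≡ᵇ-true eq = refl

ind-no : ∀ {m n} → m ≢ n → ind m n ≡ 0ℤ
ind-no neq rewrite ≡ᵇ-false neq = refl

∑-zero : ∀ {g : A → ℤ} xs → (∀ {x} → x ∈ xs → g x ≡ 0ℤ) → ∑ g xs ≡ 0ℤ
∑-zero []       eq = refl
∑-zero (x ∷ xs) eq rewrite eq (here refl) | ∑-zero xs (eq ∘ there) = refl

∑-pick : ∀ (g : ℕ → ℤ) {c xs} → Unique xs → c ∈ xs → ∑ (λ p → ind p c * g p) xs ≡ g c
∑-pick g {c} {x ∷ xs} (x∉ ∷ _) (here refl)
  rewrite ind-yes {c} refl
        | ∑-zero {g = λ p → ind p c * g p} xs (λ {y} y∈ →
            trans (cong (_* g y) (ind-no (All.lookup x∉ y∈ ∘ sym))) (ℤ.*-zeroˡ (g y)))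
        = trans (ℤ.+-identityʳ _) (ℤ.*-identityˡ (g c))
∑-pick g {c} {x ∷ xs} (x∉ ∷ xs!) (there c∈)
  rewrite ind-no {x} {c} (All.lookup x∉ c∈) | ∑-pick g xs! c∈
        = trans (cong (_+ g c) (ℤ.*-zeroˡ (g x))) (ℤ.+-identityˡ (g c))

-- Isolates the two indicator sums, each of which then picks out a single value of the prepended
-- entry.
∑-affine : ∀ t a b (g h : A → ℤ) xs →
           ∑ (λ p → t + (g p * a + h p * b)) xs ≡ + length xs * t + (∑ (λ p → g p * a) xs + ∑ (λ p → h p * b) xs)
∑-affine t a b g h [] = sym (trans (ℤ.+-identityʳ (0ℤ * t)) (ℤ.*-zeroˡ t))
∑-affine t a b g h (x ∷ xs) rewrite ∑-affine t a b g h xs =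
  step t (g x * a) (h x * b) (+ length xs) (∑ (λ p → g p * a) xs) (∑ (λ p → h p * b) xs)
  where
  step : ∀ t y z l s r → t + (y + z) + (l * t + (s + r)) ≡ (1ℤ + l) * t + (y + s + (z + r))
  step = solve-∀

-- Weights as coefficients of monomials

-- The coefficient of x^k y^ℓ in x^a y^b. Integer `k` and `ℓ` allow multiplication by x or y to be
-- the shift to `k - 1ℤ` or `ℓ - 1ℤ` without a special case at 0.
δ : ℕ → ℕ → ℤ → ℤ → ℤ
δ a b (+ k)    (+ ℓ)    = if (a ≡ᵇ k) ∧ (b ≡ᵇ ℓ) then 1ℤ else 0ℤ
δ a b (+ k)    -[1+ _ ] = 0ℤ
δ a b -[1+ _ ] _        = 0ℤ

δ-sucˡ : ∀ a b k ℓ → δ (suc a) b k ℓ ≡ δ a b (k - 1ℤ) ℓ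
δ-sucˡ a b (+ zero)  (+ ℓ)    = refl
δ-sucˡ a b (+ zero)  -[1+ _ ] = refl
δ-sucˡ a b (+ suc k) (+ ℓ)    = refl
δ-sucˡ a b (+ suc k) -[1+ _ ] = refl
δ-sucˡ a b -[1+ k ]  ℓ        = refl

δ-sucʳ : ∀ a b k ℓ → δ a (suc b) k ℓ ≡ δ a b k (ℓ - 1ℤ)
δ-sucʳ a b (+ k) (+ zero) with a ≡ᵇ k
... | true  = refl
... | false = refl
δ-sucʳ a b (+ k) (+ suc ℓ) = refl
δ-sucʳ a b (+ k) -[1+ ℓ ]  = refl
δ-sucʳ a b -[1+ k ] ℓ      = refl

weight : ℤ → ℤ → List ℕ → ℤ
weight k ℓ w = δ (occ (q₁ R-A36) w) (occ (q₂ R-A36) w) k ℓ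

Tℤ-∑ : ∀ n k ℓ → Tℤ R-A36 n k ℓ ≡ ∑ (weight k ℓ) (S n)
Tℤ-∑ n (+ k) (+ ℓ) = go (S n)
  where
  go : ∀ ws → + length (filterᵇ (λ w → (occ (q₁ R-A36) w ≡ᵇ k) ∧ (occ (q₂ R-A36) w ≡ᵇ ℓ)) ws) ≡
              ∑ (weight (+ k) (+ ℓ)) ws
  go [] = refl
  go (w ∷ ws) with (occ (q₁ R-A36) w ≡ᵇ k) ∧ (occ (q₂ R-A36) w ≡ᵇ ℓ)
  ... | true  = cong (λ s → 1ℤ + s) (go ws)
  ... | false = trans (go ws) (sym (ℤ.+-identityˡ _))
Tℤ-∑ n (+ k) -[1+ _ ] = sym (∑-zero (S n) λ _ → refl)
Tℤ-∑ n -[1+ _ ] ℓ     = sym (∑-zero (S n) λ _ → refl)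

new-yes : ∀ d {n p f} → IsNew d n p f → new d n p f ≡ 1
new-yes d {n} {p} {f} y with new? d n p f
... | yes _ = refl
... | no ¬y = contradiction y ¬y

new-no : ∀ d {n p f} → ¬ IsNew d n p f → new d n p f ≡ 0
new-no d {n} {p} {f} ¬y with new? d n p f
... | yes y = contradiction y ¬y
... | no _  = refl

-- For `1 ≤ f` the values 1 and `suc f` differ, so a prepended entry creates at most one occurrence
-- in all. The two corrections therefore never meet, and the weight is affine in the two indicators
-- of `p`.
δ-new : ∀ n p f a b k ℓ → 1 ≤ f →
  δ (new inc n p f ℕ.+ a) (new dec n p f ℕ.+ b) k ℓ ≡
  δ a b k ℓ + (ind p 1 * ((1ℤ - ind f n) * (δ a b (k - 1ℤ) ℓ - δ a b k ℓ))
            + ind p (suc f) * ((1ℤ - ind f 1) * (δ a b k (ℓ - 1ℤ) - δ a b k ℓ)))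
δ-new n p f a b k ℓ 1≤f = go (p ≟ 1) (p ≟ suc f) (f ≟ n) (f ≟ 1)
  where
  t = δ a b k ℓ
  x = δ a b (k - 1ℤ) ℓ
  y = δ a b k (ℓ - 1ℤ)
  rhs : (i j α β : ℤ) → ℤ
  rhs i j α β = t + (i * ((1ℤ - α) * (x - t)) + j * ((1ℤ - β) * (y - t)))
  none : ∀ t x y α β → t ≡ t + (0ℤ * ((1ℤ - α) * (x - t)) + 0ℤ * ((1ℤ - β) * (y - t)))
  none = solve-∀
  blocked₁ : ∀ t x y β → t ≡ t + (1ℤ * ((1ℤ - 1ℤ) * (x - t)) + 0ℤ * ((1ℤ - β) * (y - t)))
  blocked₁ = solve-∀
  added₁ : ∀ t x y β → x ≡ t + (1ℤ * ((1ℤ - 0ℤ) * (x - t)) + 0ℤ * ((1ℤ - β) * (y - t)))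
  added₁ = solve-∀
  blocked₂ : ∀ t x y α → t ≡ t + (0ℤ * ((1ℤ - α) * (x - t)) + 1ℤ * ((1ℤ - 1ℤ) * (y - t)))
  blocked₂ = solve-∀
  added₂ : ∀ t x y α → y ≡ t + (0ℤ * ((1ℤ - α) * (x - t)) + 1ℤ * ((1ℤ - 0ℤ) * (y - t)))
  added₂ = solve-∀
  lhs : ∀ {i j} → new inc n p f ≡ i → new dec n p f ≡ j →
        δ (new inc n p f ℕ.+ a) (new dec n p f ℕ.+ b) k ℓ ≡ δ (i ℕ.+ a) (j ℕ.+ b) k ℓ
  lhs eq eq′ = cong₂ (λ i j → δ (i ℕ.+ a) (j ℕ.+ b) k ℓ) eq eq′
  go : _ → _ → _ → _ →
    δ (new inc n p f ℕ.+ a) (new dec n p f ℕ.+ b) k ℓ ≡ rhs (ind p 1) (ind p (suc f)) (ind f n) (ind f 1)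
  go (yes p≡1) (yes p≡sf) _ _ = contradiction (trans (sym p≡1) p≡sf) (<⇒≢ (s≤s 1≤f))
  go (yes p≡1) (no p≢sf) (yes f≡n) _
    rewrite lhs (new-no inc (λ (_ , f≢n) → f≢n f≡n)) (new-no dec (p≢sf ∘ proj₁))
          | ind-yes p≡1 | ind-no p≢sf | ind-yes f≡n = blocked₁ t x y (ind f 1)
  go (yes p≡1) (no p≢sf) (no f≢n) _
    rewrite lhs (new-yes inc (p≡1 , f≢n)) (new-no dec (p≢sf ∘ proj₁)) | δ-sucˡ a b k ℓ
          | ind-yes p≡1 | ind-no p≢sf | ind-no f≢n = added₁ t x y (ind f 1)
  go (no p≢1) (yes p≡sf) _ (yes f≡1)
    rewrite lhs (new-no inc (p≢1 ∘ proj₁)) (new-no dec (λ (_ , f≢1) → f≢1 f≡1))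
          | ind-no p≢1 | ind-yes p≡sf | ind-yes f≡1 = blocked₂ t x y (ind 1 n)
  go (no p≢1) (yes p≡sf) _ (no f≢1)
    rewrite lhs (new-no inc (p≢1 ∘ proj₁)) (new-yes dec (p≡sf , f≢1)) | δ-sucʳ a b k ℓ
          | ind-no p≢1 | ind-yes p≡sf | ind-no f≢1 = added₂ t x y (ind f n)
  go (no p≢1) (no p≢sf) _ _
    rewrite lhs (new-no inc (p≢1 ∘ proj₁)) (new-no dec (p≢sf ∘ proj₁))
          | ind-no p≢1 | ind-no p≢sf = none t x y (ind f n) (ind f 1)

-- The linear system for the three sums

-- The coefficients at x^k y^ℓ of the generating functions T, F and L, in this order.
total maxFirst minFirst : ℕ → ℤ → ℤ → ℤ
total    n k ℓ = ∑ (weight k ℓ) (S n)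
maxFirst   n k ℓ = ∑ (λ w → ind (val w 1) n * weight k ℓ w) (S n)
minFirst n k ℓ = ∑ (λ w → ind (val w 1) 1 * weight k ℓ w) (S n)

-- The change of weight when the prepended entry is 1, respectively one above the first value of
-- `u`; it is zero in the exceptional case.
gain₁ gain₂ : ℕ → ℤ → ℤ → List ℕ → ℤ
gain₁ n k ℓ u = (1ℤ - ind (val u 1) n) * (weight (k - 1ℤ) ℓ u - weight k ℓ u)
gain₂ n k ℓ u = (1ℤ - ind (val u 1) 1) * (weight k (ℓ - 1ℤ) u - weight k ℓ u)

first-range : ∀ {n u} → 1 ≤ n → u ∈ S n → val u 1 ∈[1… n ]
first-range {n} {u} 1≤n u∈ = π-range (permutation⇒Inverses (∈-S⁻ {n} {u} u∈)) (≤-refl , 1≤n)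

weight-prepend : ∀ {n p u} k ℓ → 1 ≤ n → p ∈ oneTo (suc n) → u ∈ S n →
  weight k ℓ (prepend p u) ≡
  weight k ℓ u + (ind p 1 * gain₁ n k ℓ u + ind p (suc (val u 1)) * gain₂ n k ℓ u)
weight-prepend {n} {p} {u} k ℓ 1≤n p∈ u∈ = trans
  (cong₂ (λ a b → δ a b k ℓ) (occ-prepend 1≤n (∈-oneTo⁻ p∈) u! inc) (occ-prepend 1≤n (∈-oneTo⁻ p∈) u! dec))
  (δ-new n p (val u 1) (occ (q₁ R-A36) u) (occ (q₂ R-A36) u) k ℓ (proj₁ (first-range {u = u} 1≤n u∈)))
  where u! = ∈-S⁻ {n} {u} u∈

length-oneTo : ∀ n → length (oneTo n) ≡ n
length-oneTo n = trans (length-map suc (upTo n)) (length-upTo n)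

∑-weight-prepend : ∀ {n u} k ℓ → 1 ≤ n → u ∈ S n →
  ∑ (λ p → weight k ℓ (prepend p u)) (oneTo (suc n)) ≡ + suc n * weight k ℓ u + (gain₁ n k ℓ u + gain₂ n k ℓ u)
∑-weight-prepend {n} {u} k ℓ 1≤n u∈ = begin
  ∑ (λ p → weight k ℓ (prepend p u)) (oneTo (suc n))
    ≡⟨ ∑-cong (oneTo (suc n)) (λ p∈ → weight-prepend k ℓ 1≤n p∈ u∈) ⟩
  ∑ (λ p → t + (ind p 1 * a + ind p (suc f) * b)) (oneTo (suc n))
    ≡⟨ ∑-affine t a b (λ p → ind p 1) (λ p → ind p (suc f)) (oneTo (suc n)) ⟩
  + length (oneTo (suc n)) * t + (∑ (λ p → ind p 1 * a) (oneTo (suc n)) + ∑ (λ p → ind p (suc f) * b) (oneTo (suc n)))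
    ≡⟨ cong₂ (λ m s → + m * t + s) (length-oneTo (suc n))
         -- Both special entries, 1 and `suc f`, lie in 1,...,n + 1, so each indicator sum has
         -- exactly one nonzero indicator.
         (cong₂ _+_ (∑-pick (λ _ → a) (oneTo-unique (suc n)) (∈-oneTo⁺ (≤-refl , s≤s z≤n)))
                    (∑-pick (λ _ → b) (oneTo-unique (suc n)) (∈-oneTo⁺ (s≤s z≤n , s≤s (proj₂ f∈))))) ⟩
  + suc n * t + (a + b) ∎
  where
  open ≡-Reasoning
  t = weight k ℓ u
  a = gain₁ n k ℓ u
  b = gain₂ n k ℓ u
  f = val u 1
  f∈ = first-range {u = u} 1≤n u∈

∑-first-prepend : ∀ {n u} k ℓ {c} → c ∈[1… suc n ] → 1 ≤ n → u ∈ S n →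
  ∑ (λ p → ind p c * weight k ℓ (prepend p u)) (oneTo (suc n)) ≡
  weight k ℓ u + (ind c 1 * gain₁ n k ℓ u + ind c (suc (val u 1)) * gain₂ n k ℓ u)
∑-first-prepend {n} {u} k ℓ {c} c∈ 1≤n u∈ = trans
  (∑-pick (λ p → weight k ℓ (prepend p u)) (oneTo-unique (suc n)) (∈-oneTo⁺ c∈))
  (weight-prepend k ℓ 1≤n (∈-oneTo⁺ c∈) u∈)

-- Here `c` counts the choices of the prepended entry. Two of them, 1 and `suc f`, trade the weight
-- for a shifted one, whence `c - + 2`; the terms with `α` and `β` restore the weight in the
-- exceptional cases.
∑-total : ∀ c (t x y α β : List ℕ → ℤ) us →
  ∑ (λ u → c * t u + ((1ℤ - α u) * (x u - t u) + (1ℤ - β u) * (y u - t u))) us ≡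
  (c - + 2) * ∑ t us + ∑ x us + ∑ y us
    + (∑ (λ u → α u * t u) us - ∑ (λ u → α u * x u) us)
    + (∑ (λ u → β u * t u) us - ∑ (λ u → β u * y u) us)
∑-total c t x y α β [] = step c
  where
  step : ∀ c → 0ℤ ≡ (c - + 2) * 0ℤ + 0ℤ + 0ℤ + (0ℤ - 0ℤ) + (0ℤ - 0ℤ)
  step = solve-∀
∑-total c t x y α β (u ∷ us) = trans
  (cong (λ s → c * t u + ((1ℤ - α u) * (x u - t u) + (1ℤ - β u) * (y u - t u)) + s) (∑-total c t x y α β us))
  (step c (t u) (x u) (y u) (α u) (β u) (∑ t us) (∑ x us) (∑ y us)
    (∑ (λ u → α u * t u) us) (∑ (λ u → α u * x u) us) (∑ (λ u → β u * t u) us) (∑ (λ u → β u * y u) us))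
  where
  step : ∀ c t x y α β T X Y αT αX βT βY →
    c * t + ((1ℤ - α) * (x - t) + (1ℤ - β) * (y - t)) + ((c - + 2) * T + X + Y + (αT - αX) + (βT - βY)) ≡
    (c - + 2) * (t + T) + (x + X) + (y + Y) + (α * t + αT - (α * x + αX)) + (β * t + βT - (β * y + βY))
  step = solve-∀

∑-minFirst : ∀ (t x α : List ℕ → ℤ) us →
  ∑ (λ u → t u + (1ℤ - α u) * (x u - t u)) us ≡
  ∑ x us + ∑ (λ u → α u * t u) us - ∑ (λ u → α u * x u) us
∑-minFirst t x α [] = refl
∑-minFirst t x α (u ∷ us) = trans
  (cong (λ s → t u + (1ℤ - α u) * (x u - t u) + s) (∑-minFirst t x α us))
  (step (t u) (x u) (α u) (∑ x us) (∑ (λ u → α u * t u) us) (∑ (λ u → α u * x u) us))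
  where
  step : ∀ t x α X αT αX → t + (1ℤ - α) * (x - t) + (X + αT - αX) ≡ x + X + (α * t + αT) - (α * x + αX)
  step = solve-∀

∑-maxFirst : ∀ (t y α : List ℕ → ℤ) us →
  ∑ (λ u → t u + α u * (y u - t u)) us ≡
  ∑ t us + ∑ (λ u → α u * y u) us - ∑ (λ u → α u * t u) us
∑-maxFirst t y α [] = refl
∑-maxFirst t y α (u ∷ us) = trans
  (cong (λ s → t u + α u * (y u - t u) + s) (∑-maxFirst t y α us))
  (step (t u) (y u) (α u) (∑ t us) (∑ (λ u → α u * y u) us) (∑ (λ u → α u * t u) us))
  where
  step : ∀ t y α T αY αT → t + α * (y - t) + (T + αY - αT) ≡ t + T + (α * y + αY) - (α * t + αT)
  step = solve-∀

total-suc : ∀ n k ℓ → 1 ≤ n →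
  total (suc n) k ℓ ≡ (+ suc n - + 2) * total n k ℓ + total n (k - 1ℤ) ℓ + total n k (ℓ - 1ℤ)
    + (maxFirst n k ℓ - maxFirst n (k - 1ℤ) ℓ) + (minFirst n k ℓ - minFirst n k (ℓ - 1ℤ))
total-suc n k ℓ 1≤n = trans (∑-S-suc (weight k ℓ) n)
  (trans (∑-cong (S n) (λ {u} u∈ → ∑-weight-prepend {u = u} k ℓ 1≤n u∈))
    (∑-total (+ suc n) (weight k ℓ) (weight (k - 1ℤ) ℓ) (weight k (ℓ - 1ℤ))
      (λ u → ind (val u 1) n) (λ u → ind (val u 1) 1) (S n)))

-- A word with first value 1 arises from the prepended entry 1, which can create only an occurrence
-- of 123, because `suc f` is at least 2.
minFirst-suc : ∀ n k ℓ → 1 ≤ n →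
  minFirst (suc n) k ℓ ≡ total n (k - 1ℤ) ℓ + maxFirst n k ℓ - maxFirst n (k - 1ℤ) ℓ
minFirst-suc n k ℓ 1≤n = trans (∑-S-suc (λ w → ind (val w 1) 1 * weight k ℓ w) n)
  (trans (∑-cong (S n) pointwise)
    (∑-minFirst (weight k ℓ) (weight (k - 1ℤ) ℓ) (λ u → ind (val u 1) n) (S n)))
  where
  simplify : ∀ t a b → t + (1ℤ * a + 0ℤ * b) ≡ t + a
  simplify = solve-∀
  pointwise : ∀ {u} → u ∈ S n →
    ∑ (λ p → ind p 1 * weight k ℓ (prepend p u)) (oneTo (suc n)) ≡ weight k ℓ u + gain₁ n k ℓ u
  pointwise {u} u∈ = trans (∑-first-prepend {u = u} k ℓ {1} (≤-refl , s≤s z≤n) 1≤n u∈)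
    (trans (cong (λ i → weight k ℓ u + (1ℤ * gain₁ n k ℓ u + i * gain₂ n k ℓ u))
                (ind-no {1} {suc (val u 1)} (<⇒≢ (s≤s (proj₁ (first-range {u = u} 1≤n u∈))))))
      (simplify (weight k ℓ u) (gain₁ n k ℓ u) (gain₂ n k ℓ u)))

-- The prepended entry n + 1 is one above `f` exactly when `f` is n, and then `2 ≤ n` gives `f ≢ 1`:
-- an occurrence of 321 is created precisely on the words counted by `maxFirst n`.
maxFirst-suc : ∀ n k ℓ → 2 ≤ n →
  maxFirst (suc n) k ℓ ≡ total n k ℓ + maxFirst n k (ℓ - 1ℤ) - maxFirst n k ℓ
maxFirst-suc n@(suc (suc _)) k ℓ 2≤n@(s≤s (s≤s _)) = trans (∑-S-suc (λ w → ind (val w 1) (suc n) * weight k ℓ w) n)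
  (trans (∑-cong (S n) pointwise)
    (∑-maxFirst (weight k ℓ) (weight k (ℓ - 1ℤ)) (λ u → ind (val u 1) n) (S n)))
  where
  simplify₁ : ∀ t a y → t + (0ℤ * a + 1ℤ * ((1ℤ - 0ℤ) * (y - t))) ≡ t + 1ℤ * (y - t)
  simplify₁ = solve-∀
  simplify₀ : ∀ t a b y → t + (0ℤ * a + 0ℤ * b) ≡ t + 0ℤ * (y - t)
  simplify₀ = solve-∀
  pointwise : ∀ {u} → u ∈ S n →
    ∑ (λ p → ind p (suc n) * weight k ℓ (prepend p u)) (oneTo (suc n)) ≡
    weight k ℓ u + ind (val u 1) n * (weight k (ℓ - 1ℤ) u - weight k ℓ u)
  simplify : ∀ f (t a y : ℤ) →
    t + (0ℤ * a + ind (suc n) (suc f) * ((1ℤ - ind f 1) * (y - t))) ≡ t + ind f n * (y - t)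
  simplify f t a y with f ≟ n
  ... | yes refl rewrite ind-yes {n} refl | ind-no {n} {1} (<⇒≢ 2≤n ∘ sym) = simplify₁ t a y
  ... | no f≢n   rewrite ind-no {suc n} {suc f} (f≢n ∘ sym ∘ suc-injective) | ind-no f≢n =
    simplify₀ t a ((1ℤ - ind f 1) * (y - t)) y
  pointwise {u} u∈ = trans (∑-first-prepend {u = u} k ℓ {suc n} (s≤s z≤n , ≤-refl) (<⇒≤ 2≤n) u∈)
    (simplify (val u 1) (weight k ℓ u) (gain₁ n k ℓ u) (weight k (ℓ - 1ℤ) u))

-- Elimination and the three-term recurrence

private
  -- The shape of the right-hand side of the recurrence; the two middle terms `b` and `c` trade
  -- places when `k` and `ℓ` do.
  combine : (x a b c d e : ℤ) → ℤ
  combine x a b c d e = x * a + b + c + d - e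

  combine-cong : ∀ x {a a′ b b′ c c′ d d′ e e′} → a ≡ a′ → b ≡ b′ → c ≡ c′ → d ≡ d′ → e ≡ e′ →
                 combine x a b c d e ≡ combine x a′ b′ c′ d′ e′
  combine-cong x refl refl refl refl refl = refl

  combine-exchange : ∀ x a b c d e → combine x a b c d e ≡ combine x a c b d e
  combine-exchange = expanded
    where
    expanded : ∀ x a b c d e → x * a + b + c + d - e ≡ x * a + c + b + d - e
    expanded = solve-∀

  combine-zero : ∀ x → combine x 0ℤ 0ℤ 0ℤ 0ℤ 0ℤ ≡ 0ℤ
  combine-zero x = cong (λ z → z + 0ℤ + 0ℤ + 0ℤ - 0ℤ) (ℤ.*-zeroʳ x)

-- The step to size m + 2 needs F at two index pairs and L at two; expressed through size m, all
-- terms in F cancel. The hypothesis `2 ≤ m` is inherited from `maxFirst-suc`.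
total-recurrence : ∀ m k ℓ → 2 ≤ m →
  total (suc (suc m)) k ℓ ≡ + m * total (suc m) k ℓ + total (suc m) (k - 1ℤ) ℓ + total (suc m) k (ℓ - 1ℤ)
    + total m k ℓ - total m (k - 1ℤ) (ℓ - 1ℤ)
total-recurrence m k ℓ 2≤m = trans (total-suc (suc m) k ℓ (s≤s z≤n))
  (eliminate (+ m) (total (suc m) k ℓ) (total (suc m) (k - 1ℤ) ℓ) (total (suc m) k (ℓ - 1ℤ))
    (total m k ℓ) (total m (k - 1ℤ) ℓ) (total m (k - 1ℤ) (ℓ - 1ℤ))
    (maxFirst m k ℓ) (maxFirst m (k - 1ℤ) ℓ) (maxFirst m k (ℓ - 1ℤ)) (maxFirst m (k - 1ℤ) (ℓ - 1ℤ))
    (maxFirst-suc m k ℓ 2≤m) (maxFirst-suc m (k - 1ℤ) ℓ 2≤m)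
    (minFirst-suc m k ℓ (<⇒≤ 2≤m)) (minFirst-suc m k (ℓ - 1ℤ) (<⇒≤ 2≤m)))
  where
  step : ∀ m T′ T′x T′y T Tx Txy F Fx Fy Fxy →
    (+ 2 + m - + 2) * T′ + T′x + T′y + (T + Fy - F - (Tx + Fxy - Fx)) + (Tx + F - Fx - (Txy + Fy - Fxy))
    ≡ m * T′ + T′x + T′y + T - Txy
  step = solve-∀
  -- `+ suc (suc m)` computes to `+ 2 + + m`, so the size enters the ring identity as a variable.
  eliminate : ∀ m T′ T′x T′y T Tx Txy F Fx Fy Fxy {F′ F′x L′ L′y} →
    F′ ≡ T + Fy - F → F′x ≡ Tx + Fxy - Fx → L′ ≡ Tx + F - Fx → L′y ≡ Txy + Fy - Fxy →
    (+ 2 + m - + 2) * T′ + T′x + T′y + (F′ - F′x) + (L′ - L′y) ≡ m * T′ + T′x + T′y + T - Txy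
  eliminate m T′ T′x T′y T Tx Txy F Fx Fy Fxy refl refl refl refl = step m T′ T′x T′y T Tx Txy F Fx Fy Fxy

Tℤ-recurrence : ∀ m k ℓ → 2 ≤ m →
  Tℤ R-A36 (suc (suc m)) k ℓ ≡ + m * Tℤ R-A36 (suc m) k ℓ + Tℤ R-A36 (suc m) (k - 1ℤ) ℓ
    + Tℤ R-A36 (suc m) k (ℓ - 1ℤ) + Tℤ R-A36 m k ℓ - Tℤ R-A36 m (k - 1ℤ) (ℓ - 1ℤ)
Tℤ-recurrence m k ℓ 2≤m = trans (Tℤ-∑ (suc (suc m)) k ℓ) (trans (total-recurrence m k ℓ 2≤m)
  (combine-cong (+ m) (sym (Tℤ-∑ (suc m) k ℓ)) (sym (Tℤ-∑ (suc m) (k - 1ℤ) ℓ))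
    (sym (Tℤ-∑ (suc m) k (ℓ - 1ℤ))) (sym (Tℤ-∑ m k ℓ)) (sym (Tℤ-∑ m (k - 1ℤ) (ℓ - 1ℤ)))))

-- Symmetry and vanishing

T₁-symmetric : ∀ k ℓ → T R-A36 1 k ℓ ≡ T R-A36 1 ℓ k
T₁-symmetric zero    zero    = refl
T₁-symmetric zero    (suc ℓ) = refl
T₁-symmetric (suc k) zero    = refl
T₁-symmetric (suc k) (suc ℓ) = refl

T₂-symmetric : ∀ k ℓ → T R-A36 2 k ℓ ≡ T R-A36 2 ℓ k
T₂-symmetric zero    zero    = refl
T₂-symmetric zero    (suc ℓ) = refl
T₂-symmetric (suc k) zero    = refl
T₂-symmetric (suc k) (suc ℓ) = refl

-- Evaluation over the six permutations; `k` and `ℓ` are split just far enough for their comparison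
-- with the actual counts, all 0 or 1, to compute.
T₃-symmetric : ∀ k ℓ → T R-A36 3 k ℓ ≡ T R-A36 3 ℓ k
T₃-symmetric 0             0             = refl
T₃-symmetric 0             1             = refl
T₃-symmetric 0             (suc (suc ℓ)) = refl
T₃-symmetric 1             0             = refl
T₃-symmetric 1             1             = refl
T₃-symmetric 1             (suc (suc ℓ)) = refl
T₃-symmetric (suc (suc k)) 0             = refl
T₃-symmetric (suc (suc k)) 1             = refl
T₃-symmetric (suc (suc k)) (suc (suc ℓ)) = refl

Tℤ-symmetric-base : ∀ n → (∀ k ℓ → T R-A36 n k ℓ ≡ T R-A36 n ℓ k) →
                    ∀ k ℓ → Tℤ R-A36 n k ℓ ≡ Tℤ R-A36 n ℓ k
Tℤ-symmetric-base n h (+ k)    (+ ℓ)    = cong +_ (h k ℓ)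
Tℤ-symmetric-base n h (+ k)    -[1+ _ ] = refl
Tℤ-symmetric-base n h -[1+ _ ] (+ ℓ)    = refl
Tℤ-symmetric-base n h -[1+ _ ] -[1+ _ ] = refl

-- An arbitrary family satisfying the recurrence: nothing else about the counts enters the two
-- inductions.
module _ (t : ℕ → ℤ → ℤ → ℤ)
  (recurrence : ∀ m k ℓ → 2 ≤ m →
    t (suc (suc m)) k ℓ ≡ + m * t (suc m) k ℓ + t (suc m) (k - 1ℤ) ℓ + t (suc m) k (ℓ - 1ℤ)
      + t m k ℓ - t m (k - 1ℤ) (ℓ - 1ℤ)) where

  recurrence-symmetric : (∀ k ℓ → t 2 k ℓ ≡ t 2 ℓ k) → (∀ k ℓ → t 3 k ℓ ≡ t 3 ℓ k) →
                         ∀ m k ℓ → t (2 ℕ.+ m) k ℓ ≡ t (2 ℕ.+ m) ℓ k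
  recurrence-symmetric base₂ base₃ 0 = base₂
  recurrence-symmetric base₂ base₃ 1 = base₃
  recurrence-symmetric base₂ base₃ (suc (suc m)) k ℓ = begin
    t (4 ℕ.+ m) k ℓ
      ≡⟨ recurrence (suc (suc m)) k ℓ (s≤s (s≤s z≤n)) ⟩
    combine (+ suc (suc m)) (t (3 ℕ.+ m) k ℓ) (t (3 ℕ.+ m) (k - 1ℤ) ℓ) (t (3 ℕ.+ m) k (ℓ - 1ℤ))
      (t (2 ℕ.+ m) k ℓ) (t (2 ℕ.+ m) (k - 1ℤ) (ℓ - 1ℤ))
      ≡⟨ combine-cong (+ suc (suc m))
           (recurrence-symmetric base₂ base₃ (suc m) k ℓ)
           (recurrence-symmetric base₂ base₃ (suc m) (k - 1ℤ) ℓ)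
           (recurrence-symmetric base₂ base₃ (suc m) k (ℓ - 1ℤ))
           (recurrence-symmetric base₂ base₃ m k ℓ)
           (recurrence-symmetric base₂ base₃ m (k - 1ℤ) (ℓ - 1ℤ)) ⟩
    combine (+ suc (suc m)) (t (3 ℕ.+ m) ℓ k) (t (3 ℕ.+ m) ℓ (k - 1ℤ)) (t (3 ℕ.+ m) (ℓ - 1ℤ) k)
      (t (2 ℕ.+ m) ℓ k) (t (2 ℕ.+ m) (ℓ - 1ℤ) (k - 1ℤ))
      ≡⟨ combine-exchange (+ suc (suc m)) (t (3 ℕ.+ m) ℓ k) (t (3 ℕ.+ m) ℓ (k - 1ℤ)) (t (3 ℕ.+ m) (ℓ - 1ℤ) k)
           (t (2 ℕ.+ m) ℓ k) (t (2 ℕ.+ m) (ℓ - 1ℤ) (k - 1ℤ)) ⟩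
    combine (+ suc (suc m)) (t (3 ℕ.+ m) ℓ k) (t (3 ℕ.+ m) (ℓ - 1ℤ) k) (t (3 ℕ.+ m) ℓ (k - 1ℤ))
      (t (2 ℕ.+ m) ℓ k) (t (2 ℕ.+ m) (ℓ - 1ℤ) (k - 1ℤ))
      ≡⟨ recurrence (suc (suc m)) ℓ k (s≤s (s≤s z≤n)) ⟨
    t (4 ℕ.+ m) ℓ k ∎
    where
    open ≡-Reasoning

  -- Each term on the right lowers the threshold n - 1 by at least as much as it lowers `k`. The
  -- index `ℓ` ranges over all integers, as the shifts may carry it below 0.
  recurrence-vanishes : (∀ k ℓ → t 2 (+ suc k) ℓ ≡ 0ℤ) → (∀ k ℓ → t 3 (+ suc (suc k)) ℓ ≡ 0ℤ) →
                        ∀ m k ℓ → suc m ≤ k → t (2 ℕ.+ m) (+ k) ℓ ≡ 0ℤ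
  recurrence-vanishes base₂ base₃ 0 (suc k) ℓ _ = base₂ k ℓ
  recurrence-vanishes base₂ base₃ 1 (suc (suc k)) ℓ _ = base₃ k ℓ
  recurrence-vanishes base₂ base₃ 1 (suc zero) ℓ (s≤s ())
  recurrence-vanishes base₂ base₃ (suc (suc m)) (suc k) ℓ (s≤s m<k) =
    trans (recurrence (suc (suc m)) (+ suc k) ℓ (s≤s (s≤s z≤n)))
      (trans (combine-cong (+ suc (suc m))
          (recurrence-vanishes base₂ base₃ (suc m) (suc k) ℓ (≤-trans m<k (n≤1+n k)))
          (recurrence-vanishes base₂ base₃ (suc m) k ℓ m<k)
          (recurrence-vanishes base₂ base₃ (suc m) (suc k) (ℓ - 1ℤ) (≤-trans m<k (n≤1+n k)))
          (recurrence-vanishes base₂ base₃ m (suc k) ℓ (≤-trans (<⇒≤ m<k) (n≤1+n k)))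
          (recurrence-vanishes base₂ base₃ m k (ℓ - 1ℤ) (<⇒≤ m<k)))
        (combine-zero (+ suc (suc m))))

Tℤ-symmetric : ∀ n k ℓ → 1 ≤ n → Tℤ R-A36 n k ℓ ≡ Tℤ R-A36 n ℓ k
Tℤ-symmetric 1 k ℓ _ = Tℤ-symmetric-base 1 T₁-symmetric k ℓ
Tℤ-symmetric (suc (suc m)) k ℓ _ = recurrence-symmetric (Tℤ R-A36) Tℤ-recurrence
  (Tℤ-symmetric-base 2 T₂-symmetric) (Tℤ-symmetric-base 3 T₃-symmetric) m k ℓ

Tℤ-vanishes : ∀ n k ℓ → 2 ≤ n → n ∸ 1 ≤ k → Tℤ R-A36 n (+ k) ℓ ≡ 0ℤ
Tℤ-vanishes (suc (suc m)) k ℓ _ m<k = recurrence-vanishes (Tℤ R-A36) Tℤ-recurrence base₂ base₃ m k ℓ m<k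
  where
  base₂ : ∀ k ℓ → Tℤ R-A36 2 (+ suc k) ℓ ≡ 0ℤ
  base₂ k (+ ℓ)    = refl
  base₂ k -[1+ _ ] = refl
  base₃ : ∀ k ℓ → Tℤ R-A36 3 (+ suc (suc k)) ℓ ≡ 0ℤ
  base₃ k (+ ℓ)    = refl
  base₃ k -[1+ _ ] = refl
Tℤ-vanishes (suc zero) _ _ (s≤s ()) _

-- Transfer to the four shadings

T-A36 : ∀ {R} → (R ≡ R-A33 ⊎ R ≡ R-A34 ⊎ R ≡ R-A35 ⊎ R ≡ R-A36) → ∀ n k ℓ → T R n k ℓ ≡ T R-A36 n k ℓ
T-A36 (inj₁ refl)               = T-A33
T-A36 (inj₂ (inj₁ refl))        = T-A34
T-A36 (inj₂ (inj₂ (inj₁ refl))) = T-A35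
T-A36 (inj₂ (inj₂ (inj₂ refl))) = λ _ _ _ → refl

Tℤ-cong : ∀ {R R′} n → (∀ k ℓ → T R n k ℓ ≡ T R′ n k ℓ) → ∀ k ℓ → Tℤ R n k ℓ ≡ Tℤ R′ n k ℓ
Tℤ-cong n T≡ (+ k)    (+ ℓ)    = cong +_ (T≡ k ℓ)
Tℤ-cong n T≡ (+ k)    -[1+ _ ] = refl
Tℤ-cong n T≡ -[1+ _ ] ℓ        = refl

theorem3p4 : ∀ (R : _) → (R ≡ R-A33 ⊎ R ≡ R-A34 ⊎ R ≡ R-A35 ⊎ R ≡ R-A36) →
    JointlyEquidistributed (q₁ R) (q₂ R)
    × (∀ (n k ℓ : ℕ) → 4 ≤ n →
    Tℤ R n (+ k) (+ ℓ) ≡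
    (+ (n ∸ 2)) * Tℤ R (n ∸ 1) (+ k) (+ ℓ)
    + Tℤ R (n ∸ 1) (+ k - + 1) (+ ℓ)
    + Tℤ R (n ∸ 1) (+ k) (+ ℓ - + 1)
    + Tℤ R (n ∸ 2) (+ k) (+ ℓ)
    - Tℤ R (n ∸ 2) (+ k - + 1) (+ ℓ - + 1))
    × T R 2 0 0 ≡ 2
    × T R 3 0 0 ≡ 4
    × T R 3 1 0 ≡ 1
    × T R 3 0 1 ≡ 1
    × (∀ (n k ℓ : ℕ) → 2 ≤ n → (n ∸ 1 ≤ k ⊎ n ∸ 1 ≤ ℓ) → T R n k ℓ ≡ 0)
theorem3p4 R R∈ = symmetric , recurrence , T≡ 2 0 0 , T≡ 3 0 0 , T≡ 3 1 0 , T≡ 3 0 1 , vanishes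
  where
  T≡ = T-A36 R∈
  Tℤ≡ : ∀ n k ℓ → Tℤ R n k ℓ ≡ Tℤ R-A36 n k ℓ
  Tℤ≡ n = Tℤ-cong {R} {R-A36} n (T≡ n)
  symmetric : JointlyEquidistributed (q₁ R) (q₂ R)
  symmetric n k ℓ 1≤n = trans (T≡ n k ℓ)
    (trans (ℤ.+-injective (Tℤ-symmetric n (+ k) (+ ℓ) 1≤n)) (sym (T≡ n ℓ k)))
  recurrence : ∀ (n k ℓ : ℕ) → 4 ≤ n →
    Tℤ R n (+ k) (+ ℓ) ≡
    (+ (n ∸ 2)) * Tℤ R (n ∸ 1) (+ k) (+ ℓ)
    + Tℤ R (n ∸ 1) (+ k - + 1) (+ ℓ)
    + Tℤ R (n ∸ 1) (+ k) (+ ℓ - + 1)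
    + Tℤ R (n ∸ 2) (+ k) (+ ℓ)
    - Tℤ R (n ∸ 2) (+ k - + 1) (+ ℓ - + 1)
  recurrence (suc (suc m)) k ℓ (s≤s (s≤s 2≤m)) = trans (Tℤ≡ (suc (suc m)) (+ k) (+ ℓ))
    (trans (Tℤ-recurrence m (+ k) (+ ℓ) 2≤m)
      (sym (combine-cong (+ m) (Tℤ≡ (suc m) (+ k) (+ ℓ))
        (Tℤ≡ (suc m) (+ k - 1ℤ) (+ ℓ)) (Tℤ≡ (suc m) (+ k) (+ ℓ - 1ℤ))
        (Tℤ≡ m (+ k) (+ ℓ)) (Tℤ≡ m (+ k - 1ℤ) (+ ℓ - 1ℤ)))))
  vanishes : ∀ (n k ℓ : ℕ) → 2 ≤ n → (n ∸ 1 ≤ k ⊎ n ∸ 1 ≤ ℓ) → T R n k ℓ ≡ 0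
  vanishes n k ℓ 2≤n (inj₁ n≤k) = trans (T≡ n k ℓ) (ℤ.+-injective (Tℤ-vanishes n k (+ ℓ) 2≤n n≤k))
  -- Vanishing was proved in the first index only; the symmetry exchanges the two.
  vanishes n k ℓ 2≤n (inj₂ n≤ℓ) = trans (T≡ n k ℓ) (ℤ.+-injective
    (trans (Tℤ-symmetric n (+ k) (+ ℓ) (≤-trans (s≤s z≤n) 2≤n)) (Tℤ-vanishes n ℓ (+ k) 2≤n n≤ℓ)))
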